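{- Satisfiability checking of $\mathsf{CTMTL}$ is decidable over finite timed words: there is an algorithm which, given a finite set of propositions $\Sigma$ and a $\mathsf{CTMTL}$ formula $\varphi$ over $\Sigma$, decides whether there exists a finite timed word $\rho$ over $\Sigma$ with $\rho\models\varphi$.
   Context: Timed words. Let $\Sigma$ be a finite set of propositions. A finite timed word over $\Sigma$ is $\rho=(\sigma,\tau)$ with $\sigma=\sigma_1\cdots\sigma_n$, $\tau=t_1\cdots t_n$, $\sigma_i\in 2^\Sigma\setminus\{\emptyset\}$, $t_i\in\mathbb{R}_{\ge 0}$, $t_i\le t_{i+1}$; $dom(\rho)=\{1,\dots,n\}$. Permitted intervals $I$ are open, half-open or closed intervals of nonnegative reals with endpoints in $\mathbb{N}\cup\{0,\infty\}$; $t+\langle a,b\rangle=\langle t+a,t+b\rangle$. $\mathsf{CTMTL}$ syntax: $\varphi ::= a\in\Sigma \mid true \mid \varphi\wedge\varphi \mid \neg\varphi \mid \mathsf{C}_I^{\ge n}\varphi \mid \varphi\,\mathsf{U}_{I,\eta}\,\varphi$, with $I$ a permitted interval, $n\in\mathbb{N}\cup\{0\}$ and $\eta$ a threshold formula $\#\varphi\ge n$ or $\#\varphi<n$. Semantics: $\rho,i\models a$ iff $a\in\sigma_i$; booleans as usual; $\rho,i\models \mathsf{C}_I^{\ge n}\varphi$ iff $|\{k\in dom(\rho): t_k\in t_i+I,\ \rho,k\models\varphi\}|\ge n$; $\rho,i\models\varphi_1\mathsf{U}_{I,\#\varphi\ge n}\varphi_2$ iff there is $j>i$ with $\rho,j\models\varphi_2$,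 $t_j-t_i\in I$, $\rho,k\models\varphi_1$ for all $i<k<j$, and $|\{k: i<k<j,\ \rho,k\models\varphi\}|\ge n$; similarly for $\#\varphi<n$ with "$<n$" in place of "$\ge n$". $\rho\models\varphi$ iff $\rho,1\models\varphi$. -}

module Defs where

open import Data.Fin.Base as Fin using (Fin; zero; toℕ)
open import Data.Fin.Subset using (Subset; Nonempty; _∈_; ∣_∣)
open import Data.Integer.Base using (+_)
open import Data.Nat.Base as ℕ using (ℕ; suc; _⊔_)
import Data.Nat.Properties as ℕ
open import Data.Product using (_×_; _,_; ∃; ∃-syntax)
open import Data.Rational.Base as ℚ using (ℚ; 0ℚ; ½)
import Data.Rational.Properties as ℚ
open import Data.Rational.Solver using (module +-*-Solver)
open import Data.Unit.Base using (⊤)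
open import Function.Bundles using (_⇔_)
open import Relation.Binary.PropositionalEquality using (_≡_; refl; sym; trans; cong; subst)
open import Relation.Nullary using (¬_)

------------------------------------------------------------------------
-- Real numbers

-- Cauchy sequences of rationals.  Equality of reals is never needed: only
-- the two order relations below occur in the semantics, and both respect
-- the usual equivalence of Cauchy sequences.

record ℝ : Set where
  field
    seq    : ℕ → ℚ
    cauchy : ∀ ε → 0ℚ ℚ.< ε → ∃[ N ] ∀ m n → N ℕ.≤ m → N ℕ.≤ n →
             ℚ.∣ seq m ℚ.- seq n ∣ ℚ.< ε

open ℝ public

infix 4 _≤ᴿ_ _<ᴿ_

_≤ᴿ_ : ℝ → ℝ → Set
x ≤ᴿ y = ∀ ε → 0ℚ ℚ.< ε → ∃[ N ] ∀ n → N ℕ.≤ n → seq x n ℚ.≤ seq y n ℚ.+ ε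

_<ᴿ_ : ℝ → ℝ → Set
x <ᴿ y = ∃[ ε ] 0ℚ ℚ.< ε × (∃[ N ] ∀ n → N ℕ.≤ n → seq x n ℚ.+ ε ℚ.≤ seq y n)

fromℕ : ℕ → ℝ
fromℕ k .seq _ = + k ℚ./ 1
fromℕ k .cauchy ε 0<ε = 0 , λ _ _ _ _ →
  subst (λ d → ℚ.∣ d ∣ ℚ.< ε) (sym (ℚ.+-inverseʳ (+ k ℚ./ 1))) 0<ε

private
  half-pos : ∀ ε → 0ℚ ℚ.< ε → 0ℚ ℚ.< ½ ℚ.* ε
  half-pos ε 0<ε =
    ℚ.positive⁻¹ _ ⦃ ℚ.pos*pos⇒pos ½ ε ⦃ ℚ.positive 0<ε ⦄ ⦄

  half+half : ∀ ε → ½ ℚ.* ε ℚ.+ ½ ℚ.* ε ≡ ε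
  half+half ε = trans (sym (ℚ.*-distribʳ-+ ε ½ ½)) (ℚ.*-identityˡ ε)

  sum-diff : ∀ a b c d → (a ℚ.+ b) ℚ.- (c ℚ.+ d) ≡ (a ℚ.- c) ℚ.+ (b ℚ.- d)
  sum-diff = solve 4 (λ a b c d →
    (a :+ b) :- (c :+ d) := (a :- c) :+ (b :- d)) refl
    where open +-*-Solver

  neg-diff : ∀ a b → ℚ.- a ℚ.- ℚ.- b ≡ ℚ.- (a ℚ.- b)
  neg-diff = solve 2 (λ a b → (:- a) :- (:- b) := :- (a :- b)) refl
    where open +-*-Solver

infixl 6 _+ᴿ_ _-ᴿ_

_+ᴿ_ : ℝ → ℝ → ℝ
(x +ᴿ y) .seq n = seq x n ℚ.+ seq y n
(x +ᴿ y) .cauchy ε 0<ε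
  with cauchy x (½ ℚ.* ε) (half-pos ε 0<ε) | cauchy y (½ ℚ.* ε) (half-pos ε 0<ε)
... | M , p | N , q = M ⊔ N , λ m n m≥ n≥ → begin-strict
  ℚ.∣ (seq x m ℚ.+ seq y m) ℚ.- (seq x n ℚ.+ seq y n) ∣
    ≡⟨ cong ℚ.∣_∣ (sum-diff (seq x m) (seq y m) (seq x n) (seq y n)) ⟩
  ℚ.∣ (seq x m ℚ.- seq x n) ℚ.+ (seq y m ℚ.- seq y n) ∣
    ≤⟨ ℚ.∣p+q∣≤∣p∣+∣q∣ (seq x m ℚ.- seq x n) (seq y m ℚ.- seq y n) ⟩
  ℚ.∣ seq x m ℚ.- seq x n ∣ ℚ.+ ℚ.∣ seq y m ℚ.- seq y n ∣
    <⟨ ℚ.+-mono-< (p m n (ℕ.m⊔n≤o⇒m≤o M N m≥) (ℕ.m⊔n≤o⇒m≤o M N n≥))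
                  (q m n (ℕ.m⊔n≤o⇒n≤o M N m≥) (ℕ.m⊔n≤o⇒n≤o M N n≥)) ⟩
  ½ ℚ.* ε ℚ.+ ½ ℚ.* ε
    ≡⟨ half+half ε ⟩
  ε ∎
  where open ℚ.≤-Reasoning

-ᴿ_ : ℝ → ℝ
(-ᴿ x) .seq n = ℚ.- seq x n
(-ᴿ x) .cauchy ε 0<ε with cauchy x ε 0<ε
... | N , p = N , λ m n m≥ n≥ →
  subst (ℚ._< ε)
    (sym (trans (cong ℚ.∣_∣ (neg-diff (seq x m) (seq x n)))
                (ℚ.∣-p∣≡∣p∣ (seq x m ℚ.- seq x n))))
    (p m n m≥ n≥)

_-ᴿ_ : ℝ → ℝ → ℝ
x -ᴿ y = x +ᴿ (-ᴿ y)

------------------------------------------------------------------------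
-- Intervals

data Lower (A : Set) : Set where
  [_ : A → Lower A
  ⦅_ : A → Lower A

data Upper (A : Set) : Set where
  _] : A → Upper A
  _⦆ : A → Upper A
  ∞⦆ : Upper A

record Interval (A : Set) : Set where
  constructor _,,_
  field
    lower : Lower A
    upper : Upper A

mapᴵ : ∀ {A B : Set} → (A → B) → Interval A → Interval B
mapᴵ f (l ,, u) = mapˡ l ,, mapᵘ u
  where
  mapˡ : Lower _ → Lower _
  mapˡ ([ a) = [ f a
  mapˡ (⦅ a) = ⦅ f a

  mapᵘ : Upper _ → Upper _
  mapᵘ (b ]) = f b ]
  mapᵘ (b ⦆) = f b ⦆
  mapᵘ ∞⦆    = ∞⦆

infix 4 _∈ᴵ_

_∈ᴵ_ : ℝ → Interval ℝ → Set
x ∈ᴵ (l ,, u) = above l × below u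
  where
  above : Lower ℝ → Set
  above ([ a) = a ≤ᴿ x
  above (⦅ a) = a <ᴿ x

  below : Upper ℝ → Set
  below (b ]) = x ≤ᴿ b
  below (b ⦆) = x <ᴿ b
  below ∞⦆    = ⊤

⟦_⟧ᴵ : Interval ℕ → Interval ℝ
⟦ I ⟧ᴵ = mapᴵ fromℕ I

infixl 6 _+ᴵ_

_+ᴵ_ : ℝ → Interval ℕ → Interval ℝ
t +ᴵ I = mapᴵ (λ a → t +ᴿ fromℕ a) I

------------------------------------------------------------------------
-- Timed words over the set Fin p of propositions

-- Position i of the usual 1-based numbering is the element i - 1 of Fin n.

record TimedWord (p n : ℕ) : Set where
  field
    σ        : Fin n → Subset p
    τ        : Fin n → ℝ
    nonempty : ∀ i → Nonempty (σ i)
    nonneg   : ∀ i → fromℕ 0 ≤ᴿ τ i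
    monotone : ∀ i j → toℕ j ≡ suc (toℕ i) → τ i ≤ᴿ τ j

open TimedWord public

------------------------------------------------------------------------
-- CTMTL

infixr 7 _∧′_
infix  8 ¬′_
infix  6 #_≥_ #_<_

mutual
  data Formula (p : ℕ) : Set where
    prop    : Fin p → Formula p
    true    : Formula p
    _∧′_    : Formula p → Formula p → Formula p
    ¬′_     : Formula p → Formula p
    C[_,≥_] : Interval ℕ → ℕ → Formula p → Formula p
    _U[_,_]_ : Formula p → Interval ℕ → Threshold p → Formula p → Formula p

  data Threshold (p : ℕ) : Set where
    #_≥_ : Formula p → ℕ → Threshold p
    #_<_ : Formula p → ℕ → Threshold p

-- The cardinality of { k | P k } satisfies Q.  The predicate P need not be
-- decidable, so the set is given as a subset K of Fin n with that extension.
Card : ∀ {n} → (Fin n → Set) → (ℕ → Set) → Set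
Card {n} P Q = ∃[ K ] (∀ (k : Fin n) → k ∈ K ⇔ P k) × Q ∣ K ∣

infix 4 _,_⊨_ _,_,_⊨#_ _⊨_

mutual
  _,_⊨_ : ∀ {p n} → TimedWord p n → Fin n → Formula p → Set
  ρ , i ⊨ prop a       = a ∈ σ ρ i
  ρ , i ⊨ true         = ⊤
  ρ , i ⊨ φ ∧′ ψ       = (ρ , i ⊨ φ) × (ρ , i ⊨ ψ)
  ρ , i ⊨ ¬′ φ         = ¬ (ρ , i ⊨ φ)
  ρ , i ⊨ C[ I ,≥ c ] φ =
    Card (λ k → τ ρ k ∈ᴵ τ ρ i +ᴵ I × (ρ , k ⊨ φ)) (ℕ._≥ c)
  ρ , i ⊨ φ U[ I , η ] ψ = ∃[ j ]
      i Fin.< j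
    × (ρ , j ⊨ ψ)
    × τ ρ j -ᴿ τ ρ i ∈ᴵ ⟦ I ⟧ᴵ
    × (∀ k → i Fin.< k → k Fin.< j → ρ , k ⊨ φ)
    × (ρ , i , j ⊨# η)

  _,_,_⊨#_ : ∀ {p n} → TimedWord p n → Fin n → Fin n → Threshold p → Set
  ρ , i , j ⊨# (# φ ≥ c) =
    Card (λ k → i Fin.< k × k Fin.< j × (ρ , k ⊨ φ)) (ℕ._≥ c)
  ρ , i , j ⊨# (# φ < c) =
    Card (λ k → i Fin.< k × k Fin.< j × (ρ , k ⊨ φ)) (ℕ._< c)

_⊨_ : ∀ {p n} → TimedWord p (suc n) → Formula p → Set
ρ ⊨ φ = ρ , zero ⊨ φ

{-# OPTIONS --safe #-}
module Submission where

-- Guess at each event the truth values of all temporal subformulas.  The guess is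
-- checked by letting each event spawn a token, a deterministic finite-state monitor
-- that reads the later events together with the time elapsed since its birth.  Tokens
-- are kept in cells ordered by the fractional parts of their ages.  When time elapses,
-- either the cell with the largest fractional part becomes integral, or all fractional
-- parts grow a little (shift).  A configuration with fewer tokens simulates one with
-- more, since a shift can stand in for the rotation of a missing cell.  By Higman's
-- lemma this simulation order is almost full, so it suffices to search the finitely
-- many runs in which no configuration simulates a later one.
--
-- Runs correspond to words timed by natural numbers of ticks, with N ticks per time
-- unit.  A real-timed word becomes such a word by approximating its times by rationals
-- that keep every rational difference exact and all other relevant comparisons intact.
-- This is possible only up to double negation, which suffices because the existence of
-- an accepting run has been decided.

open import Defs
open import Data.Bool.Base as Bool using (Bool; true; false; _∧_; _∨_; not; _xor_; if_then_else_)
import Data.Bool.Properties as Bool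
open import Data.Empty using (⊥; ⊥-elim)
open import Data.Fin.Base as Fin using (Fin; zero; suc; toℕ)
open import Data.Fin.Subset using (Subset; Nonempty; ∣_∣) renaming (_∈_ to _∈ˢ_)
open import Data.Fin.Subset.Properties using (nonempty?)
open import Data.Integer.Base as ℤ using (+≤+)
import Data.Integer.Properties as ℤ
open import Data.List.Base
  using (List; []; _∷_; _++_; length; map; foldl; filter; takeWhile; dropWhile; cartesianProduct; cartesianProductWith)
open import Data.List.Membership.Propositional using (_∈_; find; lose)
open import Data.List.Membership.Propositional.Properties
  using (∈-map⁺; ∈-map⁻; ∈-filter⁺; ∈-filter⁻; ∈-cartesianProduct⁺; ∈-cartesianProduct⁻; ∈-cartesianProductWith⁺)
open import Data.List.Properties using (length-++; foldl-++; takeWhile++dropWhile)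
open import Data.List.Relation.Binary.Pointwise as Pointwise using (Pointwise; []; _∷_)
open import Data.List.Relation.Binary.Sublist.Heterogeneous as Sub using (Sublist; []; _∷ʳ_; _∷_; minimum)
import Data.List.Relation.Binary.Sublist.Heterogeneous.Properties as Sub
open import Data.List.Relation.Unary.All as All using (All; []; _∷_; all?)
import Data.List.Relation.Unary.All.Properties as All
open import Data.List.Relation.Unary.AllPairs using (AllPairs; []; _∷_)
open import Data.List.Relation.Unary.Any using (here; there; any?)
open import Data.Maybe.Base using (Maybe; just; nothing)
open import Data.Nat.Base as ℕ
  using (ℕ; zero; suc; _+_; _*_; _^_; _⊔_; _≤_; _<_; _≤ᵇ_; _<ᵇ_; _≡ᵇ_; z≤n; s≤s)
import Data.Nat.Coprimality as Coprime
open import Data.Nat.Induction using (<-rec)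
import Data.Nat.Properties as ℕ
open import Data.Product using (_×_; _,_; proj₁; proj₂; ∃; ∃-syntax; Σ-syntax)
open import Data.Product.Function.NonDependent.Propositional using (_×-⇔_)
open import Data.Rational.Base as ℚ using (ℚ; 0ℚ; ½; mkℚ; *≤*; NonNegative; Positive)
import Data.Rational.Properties as ℚ
open import Data.Rational.Solver using (module +-*-Solver)
open import Data.Rational.Unnormalised.Base using (mkℚᵘ; *≡*)
import Data.Rational.Unnormalised.Properties as ℚᵘ
open import Data.Sum.Base using (_⊎_; inj₁; inj₂; [_,_]′)
open import Data.Unit.Base using (⊤; tt)
open import Data.Vec.Base as Vec using ([]; _∷_; lookup; tabulate)
import Data.Vec.Functional as F
open import Data.Vec.Properties using (lookup∘tabulate; []=⇒lookup; lookup⇒[]=)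
open import Function.Base using (_∘_; id)
open import Function.Bundles using (_⇔_; mk⇔; Equivalence)
open import Function.Properties.Equivalence using () renaming (trans to ⇔-trans; sym to ⇔-sym)
open import Relation.Binary.Definitions using (Decidable; tri<; tri≈; tri>)
open import Relation.Binary.PropositionalEquality
  using (_≡_; refl; sym; trans; cong; cong₂; subst; subst₂)
open import Relation.Nullary using (¬_; Dec; yes; no)
open import Relation.Nullary.Decidable
  using (_⊎-dec_; _×-dec_; ¬?; ¬¬-excluded-middle; decidable-stable; map′)
import Relation.Unary as Unary

-- The obstacle is that tokens accumulate without bound, one per event, so the configurations form
-- an infinite set. Termination rests on acceptance being universal: a run is accepted if every
-- token ends in an accepting state, so deleting tokens can only help.
--
-- Negation costs nothing, because a token compares the guessed truth value with the computed one
-- for equality. A label is thus checked whether it claims truth or falsity, and the labels of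
-- subformulas can be read as plain Booleans.
--
-- The counting modality is the only operator that looks beyond the strict future: an interval
-- containing 0 also admits the event itself and earlier simultaneous events, which a newly born
-- token never reads. A counter kept outside the tokens supplies them.
--
-- Ages and counts remain unbounded naturals; only their comparison is capped, at constants taken
-- from the formula. On the side of the reals, strict inequalities survive any good enough
-- approximation, but an equality between times `t` and `t′ + c` does not, which is why rational
-- differences have to be kept exact.

open Equivalence
open +-*-Solver using (solve; _:=_; _:+_; _:-_; :-_; _:*_; con)

-- Almost full relations and their intersection

-- Almost full relations: every infinite sequence x contains i < j with
-- R (x i) (x j), in the inductive form of Vytiniotis, Coquand and Wahlstedt.

data AF {X : Set} (R : X → X → Set) : Set₁ where
  now   : (∀ x y → R x y) → AF R
  later : (∀ x → AF (λ y z → R y z ⊎ R x y)) → AF R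

af-mono : ∀ {X} {R S : X → X → Set} → (∀ x y → R x y → S x y) → AF R → AF S
af-mono f (now p)   = now λ x y → f x y (p x y)
af-mono f (later p) = later λ x →
  af-mono (λ { y z (inj₁ r) → inj₁ (f y z r) ; y z (inj₂ r) → inj₂ (f x y r) }) (p x)

af-comap : ∀ {X Y} {R : X → X → Set} (f : Y → X) → AF R → AF (λ x y → R (f x) (f y))
af-comap f (now p)   = now λ x y → p (f x) (f y)
af-comap f (later p) = later λ x → af-comap f (p (f x))

private
  ⊎-pair : ∀ {A B C : Set} → C ⊎ A → C ⊎ B → C ⊎ (A × B)
  ⊎-pair (inj₁ c) _        = inj₁ c
  ⊎-pair (inj₂ _) (inj₁ c) = inj₁ c
  ⊎-pair (inj₂ a) (inj₂ b) = inj₂ (a , b)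

  ⊎-swapʳ : ∀ {A B C : Set} → (A ⊎ B) ⊎ C → (A ⊎ C) ⊎ B
  ⊎-swapʳ (inj₁ (inj₁ a)) = inj₁ (inj₁ a)
  ⊎-swapʳ (inj₁ (inj₂ b)) = inj₂ b
  ⊎-swapʳ (inj₂ c)        = inj₁ (inj₂ c)

  ⊎-distrib : ∀ {A B C D : Set} → ((A ⊎ B) ⊎ C) ⊎ D → (A ⊎ C) ⊎ (B ⊎ D)
  ⊎-distrib (inj₁ (inj₁ (inj₁ a))) = inj₁ (inj₁ a)
  ⊎-distrib (inj₁ (inj₁ (inj₂ b))) = inj₂ (inj₁ b)
  ⊎-distrib (inj₁ (inj₂ c))        = inj₁ (inj₂ c)
  ⊎-distrib (inj₂ d)               = inj₂ (inj₂ d)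

-- Coquand's constructive Ramsey theorem, in three steps: the predicates A and
-- B that are intersected first depend on no argument, then on one, then on two.

af-∧₀ : ∀ {X} {R T C : X → X → Set} {A B : Set} →
        AF R → (∀ x y → R x y → C x y ⊎ A) →
        AF T → (∀ x y → T x y → C x y ⊎ B) →
        AF (λ x y → C x y ⊎ (A × B))
af-∧₀ (now p) f afT g = af-mono
  (λ x y t → ⊎-pair (f x y (p x y)) (g x y t)) afT
af-∧₀ {C = C} {A} {B} (later p) f afT g = later λ x →
  af-mono (λ { y z (inj₁ (inj₁ c)) → inj₁ (inj₁ c)
             ; y z (inj₁ (inj₂ c)) → inj₂ (inj₁ c)
             ; y z (inj₂ ab) → inj₁ (inj₂ ab) })
    (af-∧₀ {C = λ y z → C y z ⊎ C x y} (p x)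
      (λ { y z (inj₁ r) → [ inj₁ ∘ inj₁ , inj₂ ]′ (f y z r)
         ; y z (inj₂ r) → [ inj₁ ∘ inj₂ , inj₂ ]′ (f x y r) })
      afT (λ y z t → [ inj₁ ∘ inj₁ , inj₂ ]′ (g y z t)))

af-∧₁ : ∀ {X} {R T C : X → X → Set} {A B : X → Set} →
        AF R → (∀ x y → R x y → C x y ⊎ A x) →
        AF T → (∀ x y → T x y → C x y ⊎ B x) →
        AF (λ x y → C x y ⊎ (A x × B x))
af-∧₁ (now p) f afT g = af-mono
  (λ x y t → ⊎-pair (f x y (p x y)) (g x y t)) afT
af-∧₁ afR@(later _) f (now q) g = af-mono
  (λ x y r → ⊎-pair (f x y r) (g x y (q x y))) afR
af-∧₁ {X} {C = C} {A} {B} afR@(later p) f afT@(later q) g = later λ x →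
  let C′ : X → X → Set
      C′ y z = (C y z ⊎ C x y) ⊎ (A y × B y)
  in
  -- Recursion on `p x` and recursion on `q x` both give the goal up to a spare disjunct, `A x` in
  -- one and `B x` in the other. With `x` fixed these are constants, so `af-∧₀` combines them.
  af-mono (λ _ _ → ⊎-distrib)
    (af-∧₀ {C = C′} {A x} {B x}
      (af-∧₁ {C = λ y z → (C y z ⊎ C x y) ⊎ A x} {A} {B} (p x)
        (λ { y z (inj₁ r) → [ inj₁ ∘ inj₁ ∘ inj₁ , inj₂ ]′ (f y z r)
           ; y z (inj₂ r) → [ inj₁ ∘ inj₁ ∘ inj₂ , inj₁ ∘ inj₂ ]′ (f x y r) })
        afT (λ y z t → [ inj₁ ∘ inj₁ ∘ inj₁ , inj₂ ]′ (g y z t)))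
      (λ _ _ → ⊎-swapʳ)
      (af-∧₁ {C = λ y z → (C y z ⊎ C x y) ⊎ B x} {A} {B} afR
        (λ y z r → [ inj₁ ∘ inj₁ ∘ inj₁ , inj₂ ]′ (f y z r))
        (q x)
        (λ { y z (inj₁ r) → [ inj₁ ∘ inj₁ ∘ inj₁ , inj₂ ]′ (g y z r)
           ; y z (inj₂ r) → [ inj₁ ∘ inj₁ ∘ inj₂ , inj₁ ∘ inj₂ ]′ (g x y r) }))
      (λ _ _ → ⊎-swapʳ))

af-∧₂ : ∀ {X} {R T C A B : X → X → Set} →
        AF R → (∀ x y → R x y → C x y ⊎ A x y) →
        AF T → (∀ x y → T x y → C x y ⊎ B x y) →
        AF (λ x y → C x y ⊎ (A x y × B x y))
af-∧₂ (now p) f afT g = af-mono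
  (λ x y t → ⊎-pair (f x y (p x y)) (g x y t)) afT
af-∧₂ afR@(later _) f (now q) g = af-mono
  (λ x y r → ⊎-pair (f x y r) (g x y (q x y))) afR
af-∧₂ {X} {C = C} {A} {B} afR@(later p) f afT@(later q) g = later λ x →
  let C′ : X → X → Set
      C′ y z = (C y z ⊎ C x y) ⊎ (A y z × B y z)
  in
  af-mono (λ _ _ → ⊎-distrib)
    (af-∧₁ {C = C′} {A x} {B x}
      (af-∧₂ {C = λ y z → (C y z ⊎ C x y) ⊎ A x y} {A} {B} (p x)
        (λ { y z (inj₁ r) → [ inj₁ ∘ inj₁ ∘ inj₁ , inj₂ ]′ (f y z r)
           ; y z (inj₂ r) → [ inj₁ ∘ inj₁ ∘ inj₂ , inj₁ ∘ inj₂ ]′ (f x y r) })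
        afT (λ y z t → [ inj₁ ∘ inj₁ ∘ inj₁ , inj₂ ]′ (g y z t)))
      (λ _ _ → ⊎-swapʳ)
      (af-∧₂ {C = λ y z → (C y z ⊎ C x y) ⊎ B x y} {A} {B} afR
        (λ y z r → [ inj₁ ∘ inj₁ ∘ inj₁ , inj₂ ]′ (f y z r))
        (q x)
        (λ { y z (inj₁ r) → [ inj₁ ∘ inj₁ ∘ inj₁ , inj₂ ]′ (g y z r)
           ; y z (inj₂ r) → [ inj₁ ∘ inj₁ ∘ inj₂ , inj₁ ∘ inj₂ ]′ (g x y r) }))
      (λ _ _ → ⊎-swapʳ))

af-∩ : ∀ {X} {R S : X → X → Set} → AF R → AF S → AF (λ x y → R x y × S x y)
af-∩ {X} afR afS = af-mono (λ { x y (inj₂ rs) → rs })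
  (af-∧₂ {C = λ _ _ → ⊥} afR (λ _ _ → inj₂) afS (λ _ _ → inj₂))

Maybe-rel : ∀ {X : Set} → (X → X → Set) → Maybe X → Maybe X → Set
Maybe-rel R nothing  nothing  = ⊤
Maybe-rel R (just x) (just y) = R x y
Maybe-rel R _        _        = ⊥

private
  Justs : ∀ {X : Set} → (X → X → Set) → Maybe X → Maybe X → Set
  Justs R (just x) (just y) = R x y
  Justs R _        _        = ⊤

  af-justs : ∀ {X} {R : X → X → Set} → AF R → AF (Justs R)
  af-justs (now p) = now λ { (just x) (just y) → p x y ; (just x) nothing → tt ; nothing _ → tt }
  af-justs {R = R} (later p) = later λ
    { nothing  → now λ _ _ → inj₂ tt
    ; (just x) → af-mono
        (λ { (just y) (just z) r → r ; (just y) nothing _ → inj₁ tt ; nothing _ _ → inj₁ tt })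
        (af-justs (p x)) }

  af-shape : ∀ {X : Set} → AF {Maybe X} (Maybe-rel λ _ _ → ⊤)
  af-shape = later λ
    { nothing → later λ
       { nothing  → now λ _ _ → inj₂ (inj₂ tt)
       ; (just _) → now λ { nothing _ → inj₁ (inj₂ tt) ; (just _) _ → inj₂ (inj₁ tt) } }
    ; (just _) → later λ
       { (just _) → now λ _ _ → inj₂ (inj₂ tt)
       ; nothing  → now λ { nothing _ → inj₂ (inj₁ tt) ; (just _) _ → inj₁ (inj₂ tt) } } }

-- Intersects two coarser relations: `Justs` relates `nothing` to everything, and the other sees
-- only the constructor. The latter is almost full since two of any three elements share a
-- constructor.
af-maybe : ∀ {X} {R : X → X → Set} → AF R → AF (Maybe-rel R)
af-maybe afR = af-mono
  (λ { (just x) (just y) (r , _) → r ; nothing nothing _ → tt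
     ; (just x) nothing (_ , ()) ; nothing (just y) (_ , ()) })
  (af-∩ (af-justs afR) af-shape)

af-Bool : AF {Bool} _≡_
af-Bool = af-mono (λ { false false _ → refl ; true true _ → refl ; false true () ; true false () })
  (af-comap f (af-maybe {⊤} {λ _ _ → ⊤} (now _)))
  where
  f : Bool → Maybe ⊤
  f false = nothing
  f true  = just tt

infix 4 _≈[_]_

-- Takes the place of a finite quotient: values from `c` on are identified in comparisons, while the
-- data themselves are never truncated.
_≈[_]_ : ℕ → ℕ → ℕ → Set
x ≈[ c ] y = x ≡ y ⊎ (c ≤ x × c ≤ y)

-- Induction on `c`: zero becomes `nothing`, and successors are compared through their predecessors
-- with the cap lowered by one.
af-cap : ∀ c → AF (λ x y → x ≈[ c ] y)
af-cap zero    = now λ _ _ → inj₂ (z≤n , z≤n)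
af-cap (suc c) = af-mono
  (λ { zero zero _ → inj₁ refl
     ; (suc x) (suc y) (inj₁ refl) → inj₁ refl
     ; (suc x) (suc y) (inj₂ (p , q)) → inj₂ (s≤s p , s≤s q)
     ; zero (suc y) () ; (suc x) zero () })
  (af-comap pred? (af-maybe (af-cap c)))
  where
  pred? : ℕ → Maybe ℕ
  pred? zero    = nothing
  pred? (suc n) = just n

-- After `x`, either some `y` satisfies `x ≤ y`, or all values stay below `x`, where agreement
-- capped at `x` is equality.
af-≤ : AF _≤_
af-≤ = later λ x → af-mono f (af-cap x)
  where
  f : ∀ {x} y z → y ≈[ x ] z → y ≤ z ⊎ x ≤ y
  f y z (inj₁ refl)    = inj₁ ℕ.≤-refl
  f y z (inj₂ (p , _)) = inj₂ p

-- Higman's lemma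

-- A word y not above a ∷ w splits at its first letter b above a: no letter
-- before b is above a, and the letters after b do not lie above w.

module _ {X : Set} {R : X → X → Set} (R? : Decidable R) (a : X) where
  private
    before after : List X → List X
    before = takeWhile (¬? ∘ R? a)
    after  = dropWhile (¬? ∘ R? a)

    uncons′ : List X → Maybe (X × List X)
    uncons′ []       = nothing
    uncons′ (x ∷ xs) = just (x , xs)

    after-head : ∀ y {b y₁} → after y ≡ b ∷ y₁ → R a b
    after-head (x ∷ y) e with R? a x
    after-head (x ∷ y) refl | yes r = r
    ... | no _ = after-head y e

    split : ∀ y → before y ++ after y ≡ y
    split = takeWhile++dropWhile (¬? ∘ R? a)

    -- No letter of `u` lies above `a`, so every matched pair must be related by `R` itself.
    clean : ∀ {u v} → All (¬_ ∘ R a) u → Sublist (λ y z → R y z ⊎ R a y) u v → Sublist R u v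
    clean _        []           = []
    clean ¬rs      (y ∷ʳ s)     = y ∷ʳ clean ¬rs s
    clean (_ ∷ ¬rs) (inj₁ r ∷ s) = r ∷ clean ¬rs s
    clean (¬r ∷ _) (inj₂ r ∷ s) = ⊥-elim (¬r r)

    Tails : List X → X × List X → X × List X → Set
    Tails w (b , y) (c , z) = R b c × (Sublist R y z ⊎ Sublist R w y)

    join : ∀ w y z →
           Sublist (λ y z → R y z ⊎ R a y) (before y) (before z) →
           Maybe-rel (Tails w) (uncons′ (after y)) (uncons′ (after z)) →
           Sublist R y z ⊎ Sublist R (a ∷ w) y
    join w y z s t with after y in ey | after z in ez | split y | split z
    ... | []     | []     | py | pz =
      inj₁ (subst₂ (Sublist R) py pz (Sub.++⁺ (clean (All.all-takeWhile _ y) s) []))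
    ... | b ∷ y₁ | c ∷ z₁ | py | pz with t
    ...   | r , inj₁ s₁ = inj₁ (subst₂ (Sublist R) py pz (Sub.++⁺ (clean (All.all-takeWhile _ y) s) (r ∷ s₁)))
    ...   | _ , inj₂ s₁ = inj₂ (subst (Sublist R (a ∷ w)) py (Sub.++ˡ (before y) (after-head y ey ∷ s₁)))

  af-above : AF R → AF (Sublist λ y z → R y z ⊎ R a y) →
             ∀ w → AF (λ y z → Sublist R y z ⊎ Sublist R w y) →
             AF (λ y z → Sublist R y z ⊎ Sublist R (a ∷ w) y)
  af-above afR afB w afW = af-mono (λ y z (s , t) → join w y z s t)
    (af-∩ (af-comap before afB)
          (af-comap (uncons′ ∘ after) (af-maybe (af-∩ (af-comap proj₁ afR) (af-comap proj₂ afW)))))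

-- Nested induction, on the almost-fullness of `R` outside and on the first word inside. For a first
-- word `a ∷ w`, the outer hypothesis handles the parts before the first letter above `a`, the inner
-- one the parts after it; `R?` locates that letter. If `R` is total, embedding only compares
-- lengths.
higman : ∀ {X} {R : X → X → Set} → Decidable R → AF R → AF (Sublist R)
higman R? (now p) = af-mono shorter (af-comap length af-≤)
  where
  shorter : ∀ y z → length y ≤ length z → Sublist _ y z
  shorter []      z       _         = Sub.minimum z
  shorter (x ∷ y) (c ∷ z) (s≤s l) = p x c ∷ shorter y z l
higman R? afR@(later p) = later above
  where
  above : ∀ w → AF (λ y z → Sublist _ y z ⊎ Sublist _ w y)
  above []      = now λ y z → inj₂ (minimum y)
  above (a ∷ w) = af-above R? a afR (higman (λ y z → R? y z ⊎-dec R? a y) (p a)) w (above w)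

-- Search along bad sequences

-- A deterministic transition system whose reachability problem is decided by
-- exploring runs without a pair w_i ⊑ w_j (i < j): a shortest accepted run is
-- of this kind, since accepted runs from w_j can be replayed from w_i.

module Search {W Act : Set} (exec : W → Act → W) (acts : List Act)
              {Acc : W → Set} (Acc? : Unary.Decidable Acc) where

  Legal : List Act → Set
  Legal = All (_∈ acts)

  Accepted : W → List Act → Set
  Accepted w as = Legal as × Acc (foldl exec w as)

  trace : W → List Act → List W
  trace w []       = w ∷ []
  trace w (α ∷ as) = w ∷ trace (exec w α) as

  Bad : (W → W → Set) → W → List Act → Set
  Bad R w as = AllPairs (λ x y → ¬ R x y) (trace w as)

  private
    bad-tail : ∀ {R : W → W → Set} {w ws} → All (λ y → ¬ R w y) ws → AllPairs (λ x y → ¬ R x y) ws →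
               AllPairs (λ y z → ¬ (R y z ⊎ R w y)) ws
    bad-tail []       []       = []
    bad-tail (n ∷ ns) (b ∷ bs) = All.map (λ ¬r → [ ¬r , n ]′) b ∷ bad-tail ns bs

    first : ∀ w as → w ∈ trace w as
    first w []       = here refl
    first w (_ ∷ as) = here refl

  -- Recursion on the almost-fullness proof. Leaving `w` turns `R` into `R y z ⊎ R w y`, one level
  -- further down the proof, and a bad trace through `w` has a tail that is bad for the new
  -- relation. Under `now` no trace with two configurations is bad, so only the empty run remains.
  search : ∀ {R} → AF R → ∀ w → (∃ (Accepted w)) ⊎ (∀ as → Bad R w as → ¬ Accepted w as)
  search afR w with Acc? w
  ... | yes a = inj₁ ([] , [] , a)
  search (now p) w | no ¬a = inj₂ λ
    { [] _ (_ , a)      → ¬a a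
    ; (α ∷ as) (n ∷ _) _ → All.lookup n (first _ as) (p _ _) }
  search {R} (later p) w | no ¬a with attempt (All.tabulate id)
    where
    Fails : Act → Set
    Fails α = ∀ as → Bad R w (α ∷ as) → ¬ Accepted w (α ∷ as)

    attempt : ∀ {αs} → All (_∈ acts) αs → ∃ (Accepted w) ⊎ All Fails αs
    attempt []                = inj₂ []
    attempt {α ∷ _} (m ∷ ms) with search (p w) (exec w α) | attempt ms
    ... | inj₁ (as , l , a) | _       = inj₁ (α ∷ as , m ∷ l , a)
    ... | inj₂ _            | inj₁ r  = inj₁ r
    ... | inj₂ f            | inj₂ fs =
      inj₂ ((λ { as (n ∷ b) (_ ∷ l , a) → f as (bad-tail n b) (l , a) }) ∷ fs)
  ... | inj₁ r  = inj₁ r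
  ... | inj₂ fs = inj₂ λ
    { [] _ (_ , a)             → ¬a a
    ; (α ∷ as) b (m ∷ l , a) → All.lookup fs m as b (m ∷ l , a) }

  module _ {_⊑_ : W → W → Set}
           (simulate : ∀ {w v} → w ⊑ v → ∀ {α} → α ∈ acts → ∃[ β ] β ∈ acts × exec w β ⊑ exec v α)
           (Acc-mono : ∀ {w v} → w ⊑ v → Acc v → Acc w) where

    replay : ∀ {w v} → w ⊑ v → ∀ as → Accepted v as → ∃[ bs ] length bs ≡ length as × Accepted w bs
    replay r []       (_ , a)      = [] , refl , [] , Acc-mono r a
    replay r (α ∷ as) (m ∷ l , a) with simulate r m
    ... | β , m′ , r′ with replay r′ as (l , a)
    ...   | bs , e , l′ , a′ = β ∷ bs , cong suc e , m′ ∷ l′ , a′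

    none : ∀ {w₀} → (∀ as → Bad _⊑_ w₀ as → ¬ Accepted w₀ as) → ∀ as → ¬ Accepted w₀ as
    none {w₀} fail as = <-rec (λ n → ∀ as → length as ≡ n → ¬ Accepted w₀ as) step _ as refl
      where
      step : ∀ n → (∀ {m} → m < n → ∀ as → length as ≡ m → ¬ Accepted w₀ as) →
             ∀ as → length as ≡ n → ¬ Accepted w₀ as
      step n IH as refl acc = fail as (bad [] as (proj₁ acc) [] refl refl (proj₂ acc)) acc
        where
        -- The bound says that at least one action lies between `w` and `v`; replaying `as` from `w`
        -- skips it and yields a shorter accepted run.
        later-incomparable : ∀ {w} xs → foldl exec w₀ xs ≡ w → Legal xs →
          ∀ {v} as → length xs + length as < n → Accepted v as → All (λ v → ¬ w ⊑ v) (trace v as)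
        incomparable : ∀ {w} xs → foldl exec w₀ xs ≡ w → Legal xs →
          ∀ {v} as → length xs + length as < n → Accepted v as → ¬ w ⊑ v
        incomparable xs refl lx as lt acc r with replay r as acc
        ... | bs , e , l , a = IH lt (xs ++ bs) (trans (length-++ xs) (cong (length xs +_) e))
              (All.++⁺ lx l , subst Acc (sym (foldl-++ exec w₀ xs bs)) a)
        later-incomparable xs e lx []       lt acc = incomparable xs e lx [] lt acc ∷ []
        later-incomparable xs e lx (α ∷ as) lt acc@(_ ∷ l , a) =
          incomparable xs e lx (α ∷ as) lt acc ∷
          later-incomparable xs e lx as (ℕ.≤-<-trans (ℕ.+-monoʳ-≤ (length xs) (ℕ.n≤1+n _)) lt) (l , a)

        bad : ∀ {w} xs as → Legal as → Legal xs → foldl exec w₀ xs ≡ w →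
              length xs + length as ≡ n → Acc (foldl exec w as) → Bad _⊑_ w as
        bad xs []       l lx e len a = [] ∷ []
        bad {w} xs (α ∷ as) (m ∷ l) lx e len a =
          later-incomparable xs e lx as (ℕ.≤-reflexive (trans (sym (ℕ.+-suc (length xs) (length as))) len)) (l , a) ∷
          bad (xs ++ α ∷ []) as l (All.++⁺ lx (m ∷ []))
              (trans (foldl-++ exec w₀ xs (α ∷ [])) (cong (λ w → exec w α) e))
              (trans (cong (_+ length as) (trans (length-++ xs) (ℕ.+-comm (length xs) 1)))
                     (trans (sym (ℕ.+-suc (length xs) (length as))) len)) a

    reachable? : AF _⊑_ → ∀ w → Dec (∃ (Accepted w))
    reachable? af w with search af w
    ... | inj₁ r = yes r
    ... | inj₂ f = no λ (as , acc) → none f as acc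

-- Interval membership of clock values

-- A clock value is given by its integer part and a flag telling whether its
-- fractional part is zero.

aboveᴬ : Lower ℕ → Bool → ℕ → Bool
aboveᴬ ([ a) z n = a ≤ᵇ n
aboveᴬ (⦅ a) z n = if z then a <ᵇ n else a ≤ᵇ n

belowᴬ : Upper ℕ → Bool → ℕ → Bool
belowᴬ (b ]) z n = if z then n ≤ᵇ b else n <ᵇ b
belowᴬ (b ⦆) z n = n <ᵇ b
belowᴬ ∞⦆    z n = true

inᴬ : Bool → ℕ → Interval ℕ → Bool
inᴬ z n (l ,, u) = aboveᴬ l z n ∧ belowᴬ u z n

lower-const : Lower ℕ → ℕ
lower-const ([ a) = a
lower-const (⦅ a) = a

upper-const : Upper ℕ → ℕ
upper-const (b ]) = b
upper-const (b ⦆) = b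
-- Neutral for the maximum taken in `bound`.
upper-const ∞⦆    = 0

-- At an integral clock value, `n ≤ b` and `a < n` still separate a constant from its successor, so
-- capping is safe only one step beyond the largest constant.
bound : Interval ℕ → ℕ
bound (l ,, u) = suc (lower-const l ⊔ upper-const u)

≤⇒≤ᵇ≡true : ∀ {m n} → m ≤ n → (m ≤ᵇ n) ≡ true
≤⇒≤ᵇ≡true {m} {n} p with m ≤ᵇ n | ℕ.≤⇒≤ᵇ p
... | true | _ = refl

≤ᵇ≡true⇒≤ : ∀ {m n} → (m ≤ᵇ n) ≡ true → m ≤ n
≤ᵇ≡true⇒≤ {m} {n} e = ℕ.≤ᵇ⇒≤ m n (subst Bool.T (sym e) tt)

>⇒≤ᵇ≡false : ∀ {m n} → n < m → (m ≤ᵇ n) ≡ false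
>⇒≤ᵇ≡false {m} {n} p with m ≤ᵇ n in e
... | false = refl
... | true  = ⊥-elim (ℕ.<⇒≱ p (≤ᵇ≡true⇒≤ e))

private
  ≤ᵇ-cong : ∀ {c m n} → m ≈[ c ] n → (c ≤ᵇ m) ≡ (c ≤ᵇ n)
  ≤ᵇ-cong (inj₁ refl)    = refl
  ≤ᵇ-cong (inj₂ (p , q)) = trans (≤⇒≤ᵇ≡true p) (sym (≤⇒≤ᵇ≡true q))

  ≈-weaken : ∀ {c c′ m n} → c ≤ c′ → m ≈[ c′ ] n → m ≈[ c ] n
  ≈-weaken l (inj₁ e)       = inj₁ e
  ≈-weaken l (inj₂ (p , q)) = inj₂ (ℕ.≤-trans l p , ℕ.≤-trans l q)

  ≈-+ : ∀ {c m n} k → m ≈[ c ] n → (m + k) ≈[ c ] (n + k)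
  ≈-+ k (inj₁ refl)    = inj₁ refl
  ≈-+ k (inj₂ (p , q)) = inj₂ (ℕ.m≤n⇒m≤n+o k p , ℕ.m≤n⇒m≤n+o k q)

  ≈-suc : ∀ {c m n} → m ≈[ c ] n → suc m ≈[ c ] suc n
  ≈-suc (inj₁ refl)    = inj₁ refl
  ≈-suc (inj₂ (p , q)) = inj₂ (ℕ.m≤n⇒m≤1+n p , ℕ.m≤n⇒m≤1+n q)

  _≈?[_]_ : ∀ m c n → Dec (m ≈[ c ] n)
  m ≈?[ c ] n = (m ℕ.≟ n) ⊎-dec ((c ℕ.≤? m) ×-dec (c ℕ.≤? n))

  ≤ᵇ-flip : ∀ {b m n} → m ≈[ suc b ] n → (m ≤ᵇ b) ≡ (n ≤ᵇ b)
  ≤ᵇ-flip (inj₁ refl)    = refl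
  ≤ᵇ-flip (inj₂ (p , q)) = trans (>⇒≤ᵇ≡false p) (sym (>⇒≤ᵇ≡false q))

  <ᵇ-flip : ∀ {b m n} → m ≈[ b ] n → (m <ᵇ b) ≡ (n <ᵇ b)
  <ᵇ-flip (inj₁ refl)    = refl
  <ᵇ-flip (inj₂ (p , q)) = trans (>⇒≤ᵇ≡false (s≤s p)) (sym (>⇒≤ᵇ≡false (s≤s q)))

  above-cong : ∀ l z {m n} → m ≈[ suc (lower-const l) ] n → aboveᴬ l z m ≡ aboveᴬ l z n
  above-cong ([ a) z     e = ≤ᵇ-cong (≈-weaken (ℕ.n≤1+n a) e)
  above-cong (⦅ a) true  e = ≤ᵇ-cong e
  above-cong (⦅ a) false e = ≤ᵇ-cong (≈-weaken (ℕ.n≤1+n a) e)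

  below-cong : ∀ u z {m n} → m ≈[ suc (upper-const u) ] n → belowᴬ u z m ≡ belowᴬ u z n
  below-cong (b ]) true  e = ≤ᵇ-flip e
  below-cong (b ]) false e = <ᵇ-flip (≈-weaken (ℕ.n≤1+n b) e)
  below-cong (b ⦆) z     e = <ᵇ-flip (≈-weaken (ℕ.n≤1+n b) e)
  below-cong ∞⦆    z     e = refl

inᴬ-cong : ∀ I z {m n} → m ≈[ bound I ] n → inᴬ z m I ≡ inᴬ z n I
inᴬ-cong (l ,, u) z e = cong₂ _∧_
  (above-cong l z (≈-weaken (s≤s (ℕ.m≤m⊔n (lower-const l) (upper-const u))) e))
  (below-cong u z (≈-weaken (s≤s (ℕ.m≤n⊔m (lower-const l) (upper-const u))) e))

-- Monitors for the temporal operators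

-- Each event spawns a token, which reads all later events.  Its age is the
-- integer part of the time elapsed since.  The state of the counter K is reset
-- whenever time elapses, so that it depends on simultaneous events only.

record Monitor (A : Set) : Set₁ where
  field
    K S   : Set
    k₀    : K
    upd   : K → A → K
    spawn : K → A → S
    -- Elapsed time is visible only through an oracle for interval membership, so the same monitor
    -- runs on clock values and on ticks.
    read  : (Interval ℕ → Bool) → A → S → S
    Acc   : S → Set
    Acc?  : Unary.Decidable Acc
    _≈K_  : K → K → Set
    _≈_   : ℕ × S → ℕ × S → Set
    _≈?_  : Decidable _≈_
    af-K  : AF _≈K_
    af-≈  : AF _≈_
    read-ext   : ∀ {m m′} a s → (∀ I → m I ≡ m′ I) → read m a s ≡ read m′ a s
    k₀-refl    : k₀ ≈K k₀
    upd-cong   : ∀ {k k′} a → k ≈K k′ → upd k a ≈K upd k′ a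
    spawn-cong : ∀ {k k′} a → k ≈K k′ → (0 , spawn k a) ≈ (0 , spawn k′ a)
    age-cong   : ∀ {n s n′ s′} → (n , s) ≈ (n′ , s′) → (suc n , s) ≈ (suc n′ , s′)
    read-cong  : ∀ {n s n′ s′} z a → (n , s) ≈ (n′ , s′) →
                 (n , read (inᴬ z n) a s) ≈ (n′ , read (inᴬ z n′) a s′)
    Acc-cong   : ∀ {n s n′ s′} → (n , s) ≈ (n′ , s′) → Acc s′ → Acc s

unit : ∀ {A} → Monitor A
unit = record
  { K = ⊤ ; S = ⊤ ; k₀ = tt ; upd = λ _ _ → tt ; spawn = λ _ _ → tt ; read = λ _ _ _ → tt
  ; Acc = λ _ → ⊤ ; Acc? = λ _ → yes tt ; _≈K_ = λ _ _ → ⊤ ; _≈_ = λ _ _ → ⊤ ; _≈?_ = λ _ _ → yes tt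
  ; af-K = now λ _ _ → tt ; af-≈ = now λ _ _ → tt
  ; read-ext = λ _ _ _ → refl ; k₀-refl = tt ; upd-cong = λ _ _ → tt
  ; spawn-cong = λ _ _ → tt ; age-cong = λ _ → tt ; read-cong = λ _ _ _ → tt ; Acc-cong = λ _ _ → tt }

infixr 6 _⊗_

_⊗_ : ∀ {A} → Monitor A → Monitor A → Monitor A
M ⊗ N = record
  { K = M.K × N.K ; S = M.S × N.S ; k₀ = M.k₀ , N.k₀
  ; upd = λ (k , l) a → M.upd k a , N.upd l a
  ; spawn = λ (k , l) a → M.spawn k a , N.spawn l a
  ; read = λ m a (s , t) → M.read m a s , N.read m a t
  ; Acc = λ (s , t) → M.Acc s × N.Acc t
  ; Acc? = λ (s , t) → M.Acc? s ×-dec N.Acc? t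
  ; _≈K_ = λ (k , l) (k′ , l′) → (k M.≈K k′) × (l N.≈K l′)
  ; _≈_ = λ (n , s , t) (n′ , s′ , t′) → ((n , s) M.≈ (n′ , s′)) × ((n , t) N.≈ (n′ , t′))
  ; _≈?_ = λ (n , s , t) (n′ , s′ , t′) → ((n , s) M.≈? (n′ , s′)) ×-dec ((n , t) N.≈? (n′ , t′))
  ; af-K = af-∩ (af-comap proj₁ M.af-K) (af-comap proj₂ N.af-K)
  ; af-≈ = af-∩ (af-comap (λ (n , s , t) → n , s) M.af-≈) (af-comap (λ (n , s , t) → n , t) N.af-≈)
  ; read-ext = λ a (s , t) h → cong₂ _,_ (M.read-ext a s h) (N.read-ext a t h)
  ; k₀-refl = M.k₀-refl , N.k₀-refl
  ; upd-cong = λ a (p , q) → M.upd-cong a p , N.upd-cong a q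
  ; spawn-cong = λ a (p , q) → M.spawn-cong a p , N.spawn-cong a q
  ; age-cong = λ (p , q) → M.age-cong p , N.age-cong q
  ; read-cong = λ z a (p , q) → M.read-cong z a p , N.read-cong z a q
  ; Acc-cong = λ (p , q) (a , b) → M.Acc-cong p a , N.Acc-cong q b }
  where
  module M = Monitor M
  module N = Monitor N

bit : Bool → ℕ
bit true  = 1
bit false = 0

-- `K` counts the simultaneous events up to and including the current one, provided 0 lies in `I`. A
-- token starts from this count, since configurations update the counter before spawning, and then
-- adds the later events.
cMonitor : ∀ {A} → Interval ℕ → ℕ → (out sub : A → Bool) → Monitor A
cMonitor I c out sub = record
  { K = ℕ ; S = Bool × ℕ ; k₀ = 0
  ; upd = λ k a → k + bit (inᴬ true 0 I ∧ sub a)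
  ; spawn = λ k a → out a , k
  ; read = λ m a (o , x) → o , x + bit (m I ∧ sub a)
  ; Acc = λ (o , x) → o ≡ (c ≤ᵇ x)
  ; Acc? = λ (o , x) → o Bool.≟ (c ≤ᵇ x)
  ; _≈K_ = λ k k′ → k ≈[ c ] k′
  ; _≈_ = λ (n , o , x) (n′ , o′ , x′) → n ≈[ bound I ] n′ × o ≡ o′ × x ≈[ c ] x′
  ; _≈?_ = λ (n , o , x) (n′ , o′ , x′) → (n ≈?[ bound I ] n′) ×-dec (o Bool.≟ o′) ×-dec (x ≈?[ c ] x′)
  ; af-K = af-cap c
  ; af-≈ = af-∩ (af-comap proj₁ (af-cap (bound I)))
                (af-∩ (af-comap (proj₁ ∘ proj₂) af-Bool) (af-comap (proj₂ ∘ proj₂) (af-cap c)))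
  ; read-ext = λ a (o , x) h → cong (λ m → o , x + bit (m ∧ sub a)) (h I)
  ; k₀-refl = inj₁ refl
  ; upd-cong = λ a p → ≈-+ _ p
  ; spawn-cong = λ a p → inj₁ refl , refl , p
  ; age-cong = λ (p , q , r) → ≈-suc p , q , r
  ; read-cong = λ {n} {s} {n′} {s′} z a (p , q , r) → p , q ,
      subst (λ m → (proj₂ s + bit (inᴬ z n I ∧ sub a)) ≈[ c ] (proj₂ s′ + bit (m ∧ sub a)))
            (inᴬ-cong I z p) (≈-+ _ r)
  ; Acc-cong = λ (_ , q , r) e → trans q (trans e (sym (≤ᵇ-cong r))) }

-- alive: lhs has held since the event; won: a witness has been read; count: the
-- number of mid events read.  The threshold is # < c if neg is set, else # ≥ c.

record UState : Set where
  constructor ustate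
  field
    label alive won : Bool
    count           : ℕ

uMonitor : ∀ {A} → Interval ℕ → (neg : Bool) → ℕ → (out lhs mid rhs : A → Bool) → Monitor A
uMonitor I neg c out lhs mid rhs = record
  { K = ⊤ ; S = UState ; k₀ = tt
  ; upd = λ _ _ → tt
  ; spawn = λ _ a → ustate (out a) true false 0
  ; read = λ m a (ustate o al w x) →
      -- A witness is judged by the old `al` and `x`: it lies outside the stretch where `lhs` must
      -- hold and `mid` is counted.
      ustate o (al ∧ lhs a) (w ∨ (al ∧ rhs a ∧ m I ∧ (neg xor (c ≤ᵇ x)))) (x + bit (mid a))
  ; Acc = λ s → label s ≡ won s
  ; Acc? = λ s → label s Bool.≟ won s
  ; _≈K_ = λ _ _ → ⊤
  ; _≈_ = λ (n , s) (n′ , s′) → n ≈[ bound I ] n′ × label s ≡ label s′ × alive s ≡ alive s′ ×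
                                 won s ≡ won s′ × count s ≈[ c ] count s′
  ; _≈?_ = λ (n , s) (n′ , s′) → (n ≈?[ bound I ] n′) ×-dec (label s Bool.≟ label s′) ×-dec
             (alive s Bool.≟ alive s′) ×-dec (won s Bool.≟ won s′) ×-dec (count s ≈?[ c ] count s′)
  ; af-K = now λ _ _ → tt
  ; af-≈ = af-∩ (af-comap proj₁ (af-cap (bound I)))
          (af-∩ (af-comap (label ∘ proj₂) af-Bool)
          (af-∩ (af-comap (alive ∘ proj₂) af-Bool)
          (af-∩ (af-comap (won ∘ proj₂) af-Bool) (af-comap (count ∘ proj₂) (af-cap c)))))
  ; read-ext = λ a (ustate o al w x) h →
      cong (λ m → ustate o (al ∧ lhs a) (w ∨ (al ∧ rhs a ∧ m ∧ (neg xor (c ≤ᵇ x)))) (x + bit (mid a))) (h I)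
  ; k₀-refl = tt
  ; upd-cong = λ _ _ → tt
  ; spawn-cong = λ _ _ → inj₁ refl , refl , refl , refl , inj₁ refl
  ; age-cong = λ (p , q) → ≈-suc p , q
  ; read-cong = λ { {s = ustate o al w x} {s′ = ustate _ _ _ x′} z a (p , refl , refl , refl , r) →
      p , refl , refl ,
      cong₂ (λ m t → w ∨ (al ∧ rhs a ∧ m ∧ (neg xor t))) (inᴬ-cong I z p) (≤ᵇ-cong r) , ≈-+ _ r }
  ; Acc-cong = λ (_ , p , _ , q , _) e → trans p (trans e (sym q)) }
  where open UState

-- Configurations and their simulation order

data Act (A : Set) : Set where
  shift rotate : Act A
  event        : A → Act A

module Configurations {A : Set} (M : Monitor A) where
  open Monitor M

  Token : Set
  Token = ℕ × S

  -- Tokens in the same cell have the same fractional part, which is 0 in the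
  -- head cell and decreases along the tail.

  record Config : Set where
    constructor config
    field
      ctl   : K
      head  : List Token
      tail  : List (List Token)

  open Config

  older : Token → Token
  older (n , s) = suc n , s

  reads : Bool → A → Token → Token
  reads z a (n , s) = n , read (inᴬ z n) a s

  -- The first tail cell has the largest fractional part and is the next to become integral; without
  -- tail cells it is the head, after exactly one time unit. A head cell left behind has the
  -- smallest nonzero fractional part, hence goes last.
  exec : Config → Act A → Config
  exec (config k c cs)       shift     = config k₀ [] (cs ++ c ∷ [])
  exec (config k c [])       rotate    = config k₀ (map older c) []
  exec (config k c (d ∷ cs)) rotate    = config k₀ (map older d) (cs ++ c ∷ [])
  exec (config k c cs)       (event a) = config (upd k a)
    ((0 , spawn (upd k a) a) ∷ map (reads true a) c) (map (map (reads false a)) cs)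

  Accepting : Config → Set
  Accepting w = All (Acc ∘ proj₂) (head w) × All (All (Acc ∘ proj₂)) (tail w)

  Accepting? : Unary.Decidable Accepting
  Accepting? w = all? (Acc? ∘ proj₂) (head w) ×-dec all? (all? (Acc? ∘ proj₂)) (tail w)

  infix 4 _≼_ _⊑_

  _≼_ : List Token → List Token → Set
  _≼_ = Sublist _≈_

  _⊑_ : Config → Config → Set
  w ⊑ v = (ctl w ≈K ctl v) × (head w ≼ head v) × Sublist _≼_ (tail w) (tail v)

  af-⊑ : AF _⊑_
  af-⊑ = af-∩ (af-comap ctl af-K) (af-∩ (af-comap head af-≼) (af-comap tail (higman (Sub.sublist? _≈?_) af-≼)))
    where
    af-≼ : AF _≼_
    af-≼ = higman _≈?_ af-≈

  private
    map-mono : ∀ {X : Set} {R : X → X → Set} {f : X → X} → (∀ {x y} → R x y → R (f x) (f y)) →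
               ∀ {xs ys} → Sublist R xs ys → Sublist R (map f xs) (map f ys)
    map-mono {f = f} h s = Sub.map⁺ f f (Sub.map h s)

    all-mono : ∀ {X : Set} {R : X → X → Set} {P : X → Set} → (∀ {x y} → R x y → P y → P x) →
               ∀ {xs ys} → Sublist R xs ys → All P ys → All P xs
    all-mono h []       []       = []
    all-mono h (y ∷ʳ s) (_ ∷ ps) = all-mono h s ps
    all-mono h (r ∷ s)  (p ∷ ps) = h r p ∷ all-mono h s ps

  Accepting-mono : ∀ {w v} → w ⊑ v → Accepting v → Accepting w
  Accepting-mono (_ , s , t) (p , q) = all-mono Acc-cong s p , all-mono (all-mono Acc-cong) t q

  -- If v rotates a cell that has no counterpart in w, then w shifts.

  simulate : ∀ {w v} → w ⊑ v → ∀ α → ∃[ β ] (β ≡ shift ⊎ β ≡ α) × exec w β ⊑ exec v α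
  simulate (_ , s , t) shift = shift , inj₁ refl , k₀-refl , [] , Sub.++⁺ t (s ∷ [])
  simulate (_ , s , []) rotate = rotate , inj₂ refl , k₀-refl , map-mono age-cong s , []
  simulate (_ , s , _ ∷ʳ t) rotate = shift , inj₁ refl , k₀-refl , minimum _ , Sub.++⁺ t (s ∷ [])
  simulate (_ , s , r ∷ t) rotate = rotate , inj₂ refl , k₀-refl , map-mono age-cong r , Sub.++⁺ t (s ∷ [])
  simulate (e , s , t) (event a) = event a , inj₂ refl , upd-cong a e ,
    spawn-cong a (upd-cong a e) ∷ map-mono (read-cong true a) s ,
    map-mono (map-mono (read-cong false a)) t

  module _ (letters : List A) where
    acts : List (Act A)
    acts = shift ∷ rotate ∷ map event letters

    open Search exec acts Accepting? public using (Accepted; Legal)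

    accepted? : ∀ w → Dec (∃ (Accepted w))
    accepted? = Search.reachable? exec acts Accepting? simulate′ Accepting-mono af-⊑
      where
      simulate′ : ∀ {w v} → w ⊑ v → ∀ {α} → α ∈ acts → ∃[ β ] β ∈ acts × exec w β ⊑ exec v α
      simulate′ r {α} m with simulate r α
      ... | _ , inj₁ refl , r′ = shift , here refl , r′
      ... | _ , inj₂ refl , r′ = α , m , r′

-- Clock values measured in ticks

private
  ≤ᵇ-⇔ : ∀ m n m′ n′ → (m ≤ n → m′ ≤ n′) → (m′ ≤ n′ → m ≤ n) → (m ≤ᵇ n) ≡ (m′ ≤ᵇ n′)
  ≤ᵇ-⇔ m n m′ n′ f g with m ℕ.≤? n
  ... | yes p = trans (≤⇒≤ᵇ≡true p) (sym (≤⇒≤ᵇ≡true (f p)))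
  ... | no ¬p = trans (>⇒≤ᵇ≡false (ℕ.≰⇒> ¬p)) (sym (>⇒≤ᵇ≡false (ℕ.≰⇒> (¬p ∘ g))))

≢⇒≡ᵇ≡false : ∀ {m n} → ¬ m ≡ n → (m ≡ᵇ n) ≡ false
≢⇒≡ᵇ≡false {m} {n} ne with m ≡ᵇ n in e
... | false = refl
... | true  = ⊥-elim (ne (ℕ.≡ᵇ⇒≡ m n (subst Bool.T (sym e) tt)))

≡ᵇ-refl : ∀ n → (n ≡ᵇ n) ≡ true
≡ᵇ-refl zero    = refl
≡ᵇ-refl (suc n) = ≡ᵇ-refl n

module Ticks (N : ℕ) where

  aboveᵀ : Lower ℕ → ℕ → ℕ → Bool
  aboveᵀ ([ a) b t = (b + a * N) ≤ᵇ t
  aboveᵀ (⦅ a) b t = (b + a * N) <ᵇ t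

  belowᵀ : Upper ℕ → ℕ → ℕ → Bool
  belowᵀ (c ]) b t = t ≤ᵇ (b + c * N)
  belowᵀ (c ⦆) b t = t <ᵇ (b + c * N)
  belowᵀ ∞⦆    b t = true

  inᵀ : ℕ → ℕ → Interval ℕ → Bool
  inᵀ b t (l ,, u) = aboveᵀ l b t ∧ belowᵀ u b t

  private
    scale-≤ : ∀ b m n → m ≤ n → b + m * N ≤ b + n * N
    scale-≤ b m n l = ℕ.+-monoʳ-≤ b (ℕ.*-monoˡ-≤ N l)

    unscale-< : ∀ b m n → b + m * N < b + n * N → m < n
    unscale-< b m n l = ℕ.≰⇒> λ l′ → ℕ.<⇒≱ l (scale-≤ b n m l′)

  phase-suc : ∀ b n → b + n * N + N ≡ b + suc n * N
  phase-suc b n = trans (ℕ.+-assoc b (n * N) N) (cong (b +_) (ℕ.+-comm (n * N) N))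

  module _ (0<N : 0 < N) (b n : ℕ) where
    private
      scale-< : ∀ m n → m < n → b + m * N < b + n * N
      scale-< m n l =
        ℕ.<-≤-trans (ℕ.<-≤-trans (ℕ.m<m+n _ 0<N) (ℕ.≤-reflexive (phase-suc b m))) (scale-≤ b (suc m) n l)

      unscale-≤ : ∀ m n → b + m * N ≤ b + n * N → m ≤ n
      unscale-≤ m n l = ℕ.≮⇒≥ λ l′ → ℕ.<⇒≱ (scale-< n m l′) l

    in-head : ∀ I → inᵀ b (b + n * N) I ≡ inᴬ true n I
    in-head (l ,, u) = cong₂ _∧_ (lo l) (up u)
      where
      lo : ∀ l → aboveᵀ l b (b + n * N) ≡ aboveᴬ l true n
      lo ([ a) = ≤ᵇ-⇔ _ _ a n (unscale-≤ a n) (scale-≤ b a n)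
      lo (⦅ a) = ≤ᵇ-⇔ _ _ (suc a) n (unscale-< b a n) (scale-< a n)
      up : ∀ u → belowᵀ u b (b + n * N) ≡ belowᴬ u true n
      up (c ]) = ≤ᵇ-⇔ _ _ n c (unscale-≤ n c) (scale-≤ b n c)
      up (c ⦆) = ≤ᵇ-⇔ _ _ (suc n) c (unscale-< b n c) (scale-< n c)
      up ∞⦆    = refl

    -- The elapsed time lies strictly between `n` and `n + 1` units, so comparisons with integers
    -- depend on `n` alone, and strict and weak bounds coincide.
    in-tail : ∀ {t} I → b + n * N < t → t < b + n * N + N → inᵀ b t I ≡ inᴬ false n I
    in-tail {t} (l ,, u) p q = cong₂ _∧_ (lo l) (up u)
      where
      q′ : t < b + suc n * N
      q′ = ℕ.<-≤-trans q (ℕ.≤-reflexive (phase-suc b n))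
      lo : ∀ l → aboveᵀ l b t ≡ aboveᴬ l false n
      lo ([ a) = ≤ᵇ-⇔ _ _ a n (λ r → ℕ.s≤s⁻¹ (unscale-< b a (suc n) (ℕ.≤-<-trans r q′)))
                              (λ r → ℕ.≤-trans (scale-≤ b a n r) (ℕ.<⇒≤ p))
      lo (⦅ a) = ≤ᵇ-⇔ _ _ a n (λ r → ℕ.s≤s⁻¹ (unscale-< b a (suc n) (ℕ.<-trans r q′)))
                              (λ r → ℕ.≤-<-trans (scale-≤ b a n r) p)
      up : ∀ u → belowᵀ u b t ≡ belowᴬ u false n
      up (c ]) = ≤ᵇ-⇔ _ _ (suc n) c (λ r → unscale-< b n c (ℕ.<-≤-trans p r))
                                    (λ r → ℕ.<⇒≤ (ℕ.<-≤-trans q′ (scale-≤ b (suc n) c r)))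
      up (c ⦆) = ≤ᵇ-⇔ _ _ (suc n) c (λ r → unscale-< b n c (ℕ.<-trans p r))
                                    (λ r → ℕ.<-≤-trans q′ (scale-≤ b (suc n) c r))
      up ∞⦆    = refl

-- Words timed in ticks, and runs

Events : Set → ℕ → Set
Events A n = Fin n → A × ℕ

Increasing : ∀ {A} → ℕ → ∀ n → Events A n → Set
Increasing t zero    e = ⊤
Increasing t (suc n) e = t ≤ proj₂ (e zero) × Increasing (proj₂ (e zero)) n (e ∘ suc)

module Checks {A : Set} (M : Monitor A) (N : ℕ) where
  open Monitor M
  open Ticks N

  fold : ℕ → S → ∀ n → Events A n → S
  fold b s zero    e = s
  fold b s (suc n) e = fold b (read (inᵀ b (proj₂ (e zero))) (proj₁ (e zero)) s) n (e ∘ suc)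

  since : K → ℕ → ℕ → K
  since k t t′ = if t ≡ᵇ t′ then k else k₀

  -- The specification of acceptance in absolute time, free of cells and ages: each event's token
  -- accepts after folding over all later events. The counter `k` is the one left by the events at
  -- time `t`.
  Good : K → ℕ → ∀ n → Events A n → Set
  Good k t zero    e = ⊤
  Good k t (suc n) e =
    let (a , t′) = e zero
        k′ = upd (since k t t′) a
    in Acc (fold t′ (spawn k′ a) n (e ∘ suc)) × Good k′ t′ n (e ∘ suc)

data Chain (g : ℕ) : ℕ → List ℕ → ℕ → Set where
  []  : ∀ {x y} → x + g ≤ y → Chain g x [] y
  _∷_ : ∀ {x u us y} → x + g ≤ u → Chain g u us y → Chain g x (u ∷ us) y

private
  module _ {g : ℕ} where
    chain-≤ : ∀ {x us y} → Chain g x us y → x + g ≤ y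
    chain-≤ ([] p)  = p
    chain-≤ (p ∷ c) = ℕ.≤-trans p (ℕ.≤-trans (ℕ.m≤m+n _ g) (chain-≤ c))

    chain-snoc : ∀ {x us y z} → Chain g x us y → y + g ≤ z → Chain g x (us ++ y ∷ []) z
    chain-snoc ([] p)  q = p ∷ ([] q)
    chain-snoc (p ∷ c) q = p ∷ chain-snoc c q

    chain-bounds : ∀ {x us y} → Chain g x us y → All (λ u → x + g ≤ u × u + g ≤ y) us
    chain-bounds ([] p)  = []
    chain-bounds (p ∷ c) = (p , chain-≤ c) ∷
      All.map (λ (q , r) → ℕ.≤-trans p (ℕ.≤-trans (ℕ.m≤m+n _ g) q) , r) (chain-bounds c)

  chain-weaken : ∀ {g h x us y} → h ≤ g → Chain g x us y → Chain h x us y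
  chain-weaken l ([] p)  = [] (ℕ.≤-trans (ℕ.+-monoʳ-≤ _ l) p)
  chain-weaken l (p ∷ c) = ℕ.≤-trans (ℕ.+-monoʳ-≤ _ l) p ∷ chain-weaken l c

-- N is the number of ticks in a time unit, x + N is the current time, and the
-- phase of a token is its birth time plus N times its age: it is x + N in the
-- head cell, and us lists the phases of the tail cells.

data Run {A : Set} (N : ℕ) : ℕ → List ℕ → List (Act A) → ∀ n → Events A n → Set where
  stop    : ∀ {x us e} → Run N x us [] 0 e
  event   : ∀ {x us as n e} → Chain 1 x us (x + N) → proj₂ (e zero) ≡ x + N →
            Run N x us as n (e ∘ suc) → Run N x us (event (proj₁ (e zero)) ∷ as) (suc n) e
  shift   : ∀ {x x′ us as n e} → x < x′ → Run N x′ (us ++ x + N ∷ []) as n e → Run N x us (shift ∷ as) n e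
  rotate  : ∀ {x u us as n e} → x < u → Run N u (us ++ x + N ∷ []) as n e → Run N x (u ∷ us) (rotate ∷ as) n e
  rotate₀ : ∀ {x as n e} → 0 < N → Run N (x + N) [] as n e → Run N x [] (rotate ∷ as) n e

run-increasing : ∀ {A N x us as n e} → Run {A} N x us as n e → Increasing (x + N) n e
run-increasing stop = tt
run-increasing {e = e} (event c p r) =
  ℕ.≤-reflexive (sym p) , subst (λ t → Increasing t _ (e ∘ suc)) (sym p) (run-increasing r)
run-increasing {N = N} {n = zero} (shift l r) = tt
run-increasing {N = N} {n = suc _} (shift l r) with run-increasing r
... | p , q = ℕ.≤-trans (ℕ.+-monoˡ-≤ N (ℕ.<⇒≤ l)) p , q
run-increasing {n = zero} (rotate l r) = tt
run-increasing {N = N} {n = suc _} (rotate l r) with run-increasing r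
... | p , q = ℕ.≤-trans (ℕ.+-monoˡ-≤ N (ℕ.<⇒≤ l)) p , q
run-increasing {n = zero} (rotate₀ l r) = tt
run-increasing {N = N} {n = suc _} (rotate₀ l r) with run-increasing r
... | p , q = ℕ.≤-trans (ℕ.+-monoˡ-≤ N (ℕ.m≤m+n _ N)) p , q

-- Acceptance of a run against the specification

module Correctness {A : Set} (M : Monitor A) (N : ℕ) where
  open Monitor M
  open Configurations M
  open Config
  open Ticks N
  open Checks M N

  Born : ℕ → Token → Set
  Born u (n , s) = ∃[ b ] b + n * N ≡ u

  -- Tokens do not store their birth time `b`; it is recovered from phase and age. The universal
  -- form transports easily along actions, and `Born` keeps it from being vacuous, which is needed
  -- when the run stops.
  Ok : ∀ {m} → Events A m → ℕ → Token → Set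
  Ok e u (n , s) = ∀ b → b + n * N ≡ u → Acc (fold b s _ e)

  Cells : (ℕ → Token → Set) → ℕ → List ℕ → List Token → List (List Token) → Set
  Cells P x us c cs = All (P (x + N)) c × Pointwise (λ u → All (P u)) us cs

  private
    older-born : ∀ {u} tok → Born u tok → Born (u + N) (older tok)
    older-born (n , _) (b , refl) = b , sym (phase-suc b n)

    older-ok : ∀ {m} (e : Events A m) {u} tok → Ok e u tok ⇔ Ok e (u + N) (older tok)
    older-ok e (n , _) = mk⇔
      (λ ok b p → ok b (ℕ.+-cancelʳ-≡ N _ _ (trans (phase-suc b n) p)))
      (λ ok b p → ok b (trans (sym (phase-suc b n)) (cong (_+ N) p)))

    olders-born : ∀ {u c} → All (Born u) c → All (Born (u + N)) (map older c)
    olders-born = All.map⁺ ∘ All.map λ {tok} → older-born tok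

    olders-ok : ∀ {m} (e : Events A m) {u c} → All (Ok e u) c ⇔ All (Ok e (u + N)) (map older c)
    olders-ok e = mk⇔ (All.map⁺ ∘ All.map λ {tok} → Equivalence.to (older-ok e tok))
                      (All.map (λ {tok} → Equivalence.from (older-ok e tok)) ∘ All.map⁻)

  open Equivalence

  -- The remaining events come no earlier than `t′`, hence strictly after `t`, so `since` discards
  -- `k`; on the right both of its branches are `k₀`.
  Good-elapse : ∀ {k t t′ m e} → t < t′ → Increasing t′ m e → Good k t m e ⇔ Good k₀ t′ m e
  Good-elapse {m = zero} l i = mk⇔ id id
  Good-elapse {k} {t} {t′} {suc m} {e} l (i , _)
    rewrite ≢⇒≡ᵇ≡false (ℕ.<⇒≢ (ℕ.<-≤-trans l i)) with t′ ≡ᵇ proj₂ (e zero)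
  ... | true  = mk⇔ id id
  ... | false = mk⇔ id id

  module _ {x us m} (e : Events A (suc m)) (c : Chain 1 x us (x + N)) (p : proj₂ (e zero) ≡ x + N) where
    private
      a = proj₁ (e zero)

      0<N : 0 < N
      0<N = ℕ.+-cancelˡ-≤ x _ _ (chain-≤ c)

      head-ok : ∀ {tok} → Ok e (x + N) tok ⇔ Ok (e ∘ suc) (x + N) (reads true a tok)
      head-ok {n , s} = mk⇔
        (λ ok b q → subst (λ s → Acc (fold b s _ (e ∘ suc))) (same b q) (ok b q))
        (λ ok b q → subst (λ s → Acc (fold b s _ (e ∘ suc))) (sym (same b q)) (ok b q))
        where
        same : ∀ b → b + n * N ≡ x + N → read (inᵀ b (proj₂ (e zero))) a s ≡ read (inᴬ true n) a s
        same b q = read-ext a s λ I → trans (cong (λ t → inᵀ b t I) (trans p (sym q))) (in-head 0<N b n I)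

      tail-ok : ∀ {u tok} → x + 1 ≤ u → u + 1 ≤ x + N → Ok e u tok ⇔ Ok (e ∘ suc) u (reads false a tok)
      tail-ok {u} {n , s} l l′ = mk⇔
        (λ ok b q → subst (λ s → Acc (fold b s _ (e ∘ suc))) (same b q) (ok b q))
        (λ ok b q → subst (λ s → Acc (fold b s _ (e ∘ suc))) (sym (same b q)) (ok b q))
        where
        same : ∀ b → b + n * N ≡ u → read (inᵀ b (proj₂ (e zero))) a s ≡ read (inᴬ false n) a s
        same b refl = read-ext a s λ I → trans (cong (λ t → inᵀ b t I) p)
          (in-tail 0<N b n I (subst (_≤ x + N) (ℕ.+-comm _ 1) l′)
            (ℕ.+-monoˡ-≤ N (subst (_≤ u) (ℕ.+-comm x 1) l)))

      tails-ok : ∀ {us cs} → All (λ u → x + 1 ≤ u × u + 1 ≤ x + N) us →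
                 Pointwise (λ u → All (Ok e u)) us cs ⇔
                 Pointwise (λ u → All (Ok (e ∘ suc) u)) us (map (map (reads false a)) cs)
      tails-ok bs = mk⇔ (there′ bs) (back bs _)
        where
        there′ : ∀ {us cs} → All (λ u → x + 1 ≤ u × u + 1 ≤ x + N) us →
                 Pointwise (λ u → All (Ok e u)) us cs →
                 Pointwise (λ u → All (Ok (e ∘ suc) u)) us (map (map (reads false a)) cs)
        there′ []             []       = []
        there′ ((l , l′) ∷ bs) (o ∷ os) = All.map⁺ (All.map (tail-ok l l′ .to) o) ∷ there′ bs os
        back : ∀ {us} → All (λ u → x + 1 ≤ u × u + 1 ≤ x + N) us → ∀ cs →
               Pointwise (λ u → All (Ok (e ∘ suc) u)) us (map (map (reads false a)) cs) →
               Pointwise (λ u → All (Ok e u)) us cs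
        back []              []       []       = []
        back ((l , l′) ∷ bs) (_ ∷ cs) (o ∷ os) = All.map (tail-ok l l′ .from) (All.map⁻ o) ∷ back bs cs os

    -- The acceptance condition that `Good` imposes on the current event becomes `Ok` of the spawned
    -- token, born at `x + N` with age 0. The event is at the current time, so the counter is kept.
    event-ok : ∀ {k c₀ cs} →
      let w = exec (config k c₀ cs) (event a) in
      (Cells (Ok e) x us c₀ cs × Good k (x + N) _ e) ⇔
      (Cells (Ok (e ∘ suc)) x us (head w) (tail w) × Good (ctl w) (x + N) m (e ∘ suc))
    event-ok {k} rewrite p | ≡ᵇ-refl (x + N) = mk⇔
      (λ ((o , os) , acc , g) →
        (((λ b q → subst (λ b → Acc (fold b _ _ (e ∘ suc))) (sym (trans (sym (ℕ.+-identityʳ b)) q)) acc)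
          ∷ All.map⁺ (All.map (head-ok .to) o)) , tails-ok (chain-bounds c) .to os) , g)
      (λ { ((o ∷ os , oss) , g) →
        (All.map (head-ok .from) (All.map⁻ os) , tails-ok (chain-bounds c) .from oss) , o _ (ℕ.+-identityʳ _) , g })

    event-born : ∀ {k c₀ cs} → let w = exec (config k c₀ cs) (event a) in
      Cells Born x us c₀ cs → Cells Born x us (head w) (tail w)
    event-born (b , bs) = ((x + N , ℕ.+-identityʳ _) ∷ All.map⁺ b) , go bs
      where
      go : ∀ {us cs} → Pointwise (λ u → All (Born u)) us cs →
           Pointwise (λ u → All (Born u)) us (map (map (reads false a)) cs)
      go []       = []
      go (b ∷ bs) = All.map⁺ b ∷ go bs

  private
    snoc⁺ : ∀ {P : ℕ → List Token → Set} {us u cs c} → Pointwise P us cs → P u c →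
            Pointwise P (us ++ u ∷ []) (cs ++ c ∷ [])
    snoc⁺ ps p = Pointwise.++⁺ ps (p ∷ [])

    snoc⁻ : ∀ {P Q : ℕ → List Token → Set} {us u cs c} → Pointwise Q us cs →
            Pointwise P (us ++ u ∷ []) (cs ++ c ∷ []) → Pointwise P us cs × P u c
    snoc⁻ []       (p ∷ [])     = [] , p
    snoc⁻ (_ ∷ qs) (p ∷ ps) with snoc⁻ qs ps
    ... | ps′ , p′ = p ∷ ps′ , p′

  -- Induction along the run. Final acceptance splits into the verdicts on tokens already present
  -- (`Ok`) and on those still to be spawned (`Good`); an event moves one condition from the second
  -- group to the first.
  accepting⇔good : ∀ {x us as m e k c cs} → Run N x us as m e → Cells Born x us c cs →
    Accepting (foldl exec (config k c cs) as) ⇔ (Cells (Ok e) x us c cs × Good k (x + N) m e)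
  accepting⇔good {e = e} stop (b , bs) = mk⇔
    (λ (o , os) → (All.map (λ acc _ _ → acc) o , tails bs os) , tt)
    (λ ((o , os) , _) → finish b o , finishes bs os)
    where
    tails : ∀ {us cs} → Pointwise (λ u → All (Born u)) us cs → All (All (Acc ∘ proj₂)) cs →
            Pointwise (λ u → All (Ok e u)) us cs
    tails []       []       = []
    tails (_ ∷ bs) (o ∷ os) = All.map (λ acc _ _ → acc) o ∷ tails bs os
    finish : ∀ {u c} → All (Born u) c → All (Ok e u) c → All (Acc ∘ proj₂) c
    finish []             []       = []
    finish ((b , e) ∷ bs) (o ∷ os) = o b e ∷ finish bs os
    finishes : ∀ {us cs} → Pointwise (λ u → All (Born u)) us cs → Pointwise (λ u → All (Ok e u)) us cs →
               All (All (Acc ∘ proj₂)) cs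
    finishes []       []       = []
    finishes (b ∷ bs) (o ∷ os) = finish b o ∷ finishes bs os
  accepting⇔good {e = e} (event c p r) b = mk⇔
    (event-ok e c p .from ∘ IH .to)
    (IH .from ∘ event-ok e c p .to)
    where IH = accepting⇔good r (event-born e c p b)
  accepting⇔good {e = e} (shift l r) (b , bs) = mk⇔
    (λ acc → let ((_ , os) , g) = IH .to acc
                 (os′ , o) = snoc⁻ bs os
             in (o , os′) , elapse .from g)
    (λ ((o , os) , g) → IH .from (([] , snoc⁺ os o) , elapse .to g))
    where
    IH = accepting⇔good r ([] , snoc⁺ bs b)
    elapse = Good-elapse (ℕ.+-monoˡ-< N l) (run-increasing r)
  accepting⇔good {e = e} (rotate l r) (b , d ∷ bs) = mk⇔
    (λ acc → let ((q , os) , g) = IH .to acc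
                 (os′ , o) = snoc⁻ bs os
             in (o , olders-ok e .from q ∷ os′) , elapse .from g)
    (λ { ((o , q ∷ os) , g) → IH .from ((olders-ok e .to q , snoc⁺ os o) , elapse .to g) })
    where
    IH = accepting⇔good r (olders-born d , snoc⁺ bs b)
    elapse = Good-elapse (ℕ.+-monoˡ-< N l) (run-increasing r)
  accepting⇔good {x} {e = e} (rotate₀ l r) (b , []) = mk⇔
    (λ acc → let ((q , _) , g) = IH .to acc
             in (olders-ok e .from q , []) , elapse .from g)
    (λ ((o , _) , g) → IH .from ((olders-ok e .to o , []) , elapse .to g))
    where
    IH = accepting⇔good r (olders-born b , [])
    elapse = Good-elapse (ℕ.+-monoˡ-< N (ℕ.m<m+n x l)) (run-increasing r)

-- Between action sequences and tick times

private
  +-swapʳ : ∀ m n o → m + n + o ≡ m + o + n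
  +-swapʳ m n o = trans (ℕ.+-assoc m n o) (trans (cong (m +_) (ℕ.+-comm n o)) (sym (ℕ.+-assoc m o n)))

2^-pos : ∀ r → 0 < 2 ^ r
2^-pos r = ℕ.m^n>0 2 r

-- Each shift halves the gaps between consecutive phases, so gaps of
-- 2 ^ length as ticks leave room for all of as.

schedule : ∀ {A : Set} {N} (as : List (Act A)) {x us} → Chain (2 ^ length as) x us (x + N) →
           ∃[ m ] Σ[ e ∈ Events A m ] Run N x us as m e × (∀ i → event (proj₁ (e i)) ∈ as)
schedule [] c = 0 , (λ ()) , stop , λ ()
schedule {N = N} (event a ∷ as) {x} c with schedule as (chain-weaken (ℕ.m≤m+n _ _) c)
... | m , e , r , h = suc m , (a , x + N) F.∷ e , event (chain-weaken (2^-pos (suc (length as))) c) refl r ,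
      λ { zero → here refl ; (suc i) → there (h i) }
schedule {N = N} (shift ∷ as) {x} {us} c with schedule as c′
  where
  g = 2 ^ length as
  -- The old gaps are `2 * g`. Time advances by `g`, which leaves `g` before the next phase and puts
  -- `g` between the old head phase `x + N` and the new current time.
  c′ : Chain g (x + g) (us ++ x + N ∷ []) (x + g + N)
  c′ = chain-snoc (halve c) (ℕ.≤-reflexive (+-swapʳ x N g))
    where
    move : ∀ {y} → x + 2 * g ≤ y → x + g + g ≤ y
    move = ℕ.≤-trans (ℕ.≤-reflexive (trans (ℕ.+-assoc x g g) (cong (λ h → x + (g + h)) (sym (ℕ.+-identityʳ g)))))
    halve : ∀ {us y} → Chain (2 * g) x us y → Chain g (x + g) us y
    halve ([] p)  = [] (move p)
    halve (p ∷ c) = move p ∷ chain-weaken (ℕ.m≤m+n g _) c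
... | m , e , r , h = m , e , shift (ℕ.m<m+n x (2^-pos (length as))) r , there ∘ h
schedule {N = N} (rotate ∷ as) {x} {[]} ([] p) with schedule as {x + N}
  ([] (ℕ.+-monoʳ-≤ (x + N) (ℕ.≤-trans (ℕ.m≤m+n _ _) (ℕ.+-cancelˡ-≤ x _ _ p))))
... | m , e , r , h =
  m , e , rotate₀ (ℕ.<-≤-trans (2^-pos (suc (length as))) (ℕ.+-cancelˡ-≤ x _ _ p)) r , there ∘ h
schedule {N = N} (rotate ∷ as) {x} {u ∷ us} (p ∷ c)
  with schedule as (chain-weaken (ℕ.m≤m+n _ _) (chain-snoc {z = u + N} c (ℕ.≤-trans (ℕ.≤-reflexive (+-swapʳ x N g)) (ℕ.+-monoˡ-≤ N p))))
  where g = 2 ^ suc (length as)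
... | m , e , r , h = m , e , rotate (ℕ.<-≤-trans (ℕ.m<m+n x (2^-pos (suc (length as)))) p) r , there ∘ h

-- With gaps of at least one tick, a single action advances the time by one tick.

module _ {A : Set} {N : ℕ} (letters : List A) where
  private
    actions : List (Act A)
    actions = shift ∷ rotate ∷ map event letters

  Timetable : ℕ → List ℕ → ∀ n → Events A n → Set
  Timetable x us n e = ∃[ as ] Run N x us as n e × All (_∈ actions) as

  private
    shift-tick : ∀ {x us n e} → Chain 1 (x + 1) us (x + N) →
      (∀ {us} → Chain 1 (x + 1) us (x + 1 + N) → Timetable (x + 1) us n e) → Timetable x us n e
    shift-tick {x} c IH with IH (chain-snoc c (ℕ.≤-reflexive (+-swapʳ x N 1)))
    ... | as , r , l = shift ∷ as , shift (ℕ.m<m+n x (s≤s z≤n)) r , here refl ∷ l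

    tick : ∀ {x us n e} → Chain 1 x us (x + N) →
      (∀ {us} → Chain 1 (x + 1) us (x + 1 + N) → Timetable (x + 1) us n e) → Timetable x us n e
    tick {x} ([] p) IH with ℕ.m≤n⇒m<n∨m≡n p
    ... | inj₁ p′ = shift-tick ([] (ℕ.≤-trans (ℕ.≤-reflexive (ℕ.+-comm (x + 1) 1)) p′)) IH
    -- Here `N` is 1: a single tick is a whole time unit, and the head cell itself becomes integral
    -- again.
    ... | inj₂ e with ℕ.+-cancelˡ-≡ x 1 N e
    ...   | refl with IH ([] ℕ.≤-refl)
    ...     | as , r , l = rotate ∷ as , rotate₀ (s≤s z≤n) r , there (here refl) ∷ l
    tick {x} {u ∷ us} (p ∷ c) IH with ℕ.m≤n⇒m<n∨m≡n p
    ... | inj₁ p′ = shift-tick (ℕ.≤-trans (ℕ.≤-reflexive (ℕ.+-comm (x + 1) 1)) p′ ∷ c) IH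
    ... | inj₂ refl with IH (chain-snoc c (ℕ.≤-reflexive (+-swapʳ x N 1)))
    ...   | as , r , l = rotate ∷ as , rotate (ℕ.m<m+n x (s≤s z≤n)) r , there (here refl) ∷ l

  timetable : ∀ n {e : Events A n} {x us} → Chain 1 x us (x + N) → Increasing (x + N) n e →
              (∀ i → proj₁ (e i) ∈ letters) → Timetable x us n e
  timetable zero    _ _ _ = [] , stop , []
  timetable (suc n) {e} {x} {us} c (i , is) h = wait (proj₂ (e zero) ℕ.∸ (x + N)) c (sym (ℕ.m+[n∸m]≡n i))
    where
    wait : ∀ d {x us} → Chain 1 x us (x + N) → proj₂ (e zero) ≡ x + N + d → Timetable x us (suc n) e
    wait zero {x} c p with trans p (ℕ.+-identityʳ (x + N))
    ... | p′ with timetable n c (subst (λ t → Increasing t n (e ∘ suc)) p′ is) (h ∘ suc)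
    ...   | as , r , l = event (proj₁ (e zero)) ∷ as , event c p′ r , there (there (∈-map⁺ event (h zero))) ∷ l
    wait (suc d) {x} c p = tick c λ c′ → wait d c′ (trans p (shuffle x d))
      where
      shuffle : ∀ x d → x + N + suc d ≡ x + 1 + N + d
      shuffle x d = trans (ℕ.+-suc (x + N) d) (cong (λ y → y + N + d) (ℕ.+-comm 1 x))

-- Deciding whether a good word exists

module Emptiness {A : Set} (M : Monitor A) (letters : List A) {Start : A → Set} (Start? : Unary.Decidable Start) where
  open Monitor M
  open Configurations M

  record GoodWord : Set where
    constructor goodWord
    field
      {N m}      : ℕ
      positive   : 0 < N
      word       : Events A (suc m)
      start      : Start (proj₁ (word zero))
      letter     : ∀ i → proj₁ (word i) ∈ letters
      -- A run's clock shows `x + N` and starts with `x` equal to 0. Requiring the first event at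
      -- `N` forces the run to begin with it.
      time₀      : proj₂ (word zero) ≡ N
      increasing : Increasing N (suc m) word
      good       : Checks.Good M N k₀ N (suc m) word

  private
    -- `Start` concerns the first letter, which final configurations do not record; so the first
    -- event is performed before the search, once for each letter.
    after : A → Config
    after a = exec (config k₀ [] []) (event a)

    sound : ∀ {a as} → Start a → a ∈ letters → Accepted letters (after a) as → GoodWord
    sound {a} {as} st ∈a (legal , acc) with schedule {N = 2 ^ length (event a ∷ as)} (event a ∷ as) {0} ([] ℕ.≤-refl)
    ... | suc m , e , r@(event _ p _) , h = record
      { positive   = 2^-pos (length (event a ∷ as))
      ; word       = e
      ; start      = st
      ; letter     = λ i → letter (proj₁ (e i)) (All.lookup (there (there (∈-map⁺ event ∈a)) ∷ legal) (h i))
      ; time₀      = p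
      ; increasing = run-increasing r
      ; good       = proj₂ (Equivalence.to (Correctness.accepting⇔good M _ r ([] , [])) acc)
      }
      where
      letter : ∀ b → event b ∈ acts letters → b ∈ letters
      letter b (there (there m)) with ∈-map⁻ event m
      ... | _ , m′ , refl = m′

    late : ∀ (w : GoodWord) {x} → 0 < x → ¬ x + GoodWord.N w ≤ proj₂ (GoodWord.word w zero)
    late w l l′ = ℕ.<⇒≱ (ℕ.m<n+m _ l) (ℕ.≤-trans l′ (ℕ.≤-reflexive (GoodWord.time₀ w)))

    complete : GoodWord → ∃[ a ] a ∈ letters × Start a × ∃ (Accepted letters (after a))
    complete w with timetable {N = N} letters (suc m) {word} {0} {[]} ([] positive) increasing letter
      where open GoodWord w
    ... | _ , r , l with Equivalence.from (Correctness.accepting⇔good M _ r ([] , [])) (([] , []) , GoodWord.good w)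
    complete w | _ , event _ _ _ , _ ∷ l | acc =
      _ , GoodWord.letter w zero , GoodWord.start w , _ , l , acc
    complete w | _ , shift l r , _ | _ = ⊥-elim (late w l (proj₁ (run-increasing r)))
    complete w | _ , rotate₀ l r , _ | _ = ⊥-elim (late w l (proj₁ (run-increasing r)))

  goodWord? : Dec GoodWord
  goodWord? with any? (λ a → Start? a ×-dec accepted? letters (after a)) letters
  ... | yes found with find found
  ...   | _ , ∈a , st , _ , acc = yes (sound st ∈a acc)
  goodWord? | no ¬found = no λ w → let (_ , ∈a , st , acc) = complete w in ¬found (lose ∈a (st , acc))

-- Boolean semantics

anyᶠ allᶠ : ∀ n → (Fin n → Bool) → Bool
anyᶠ zero    f = false
anyᶠ (suc n) f = f zero ∨ anyᶠ n (f ∘ suc)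
allᶠ zero    f = true
allᶠ (suc n) f = f zero ∧ allᶠ n (f ∘ suc)

countᶠ : ∀ n → (Fin n → Bool) → ℕ
countᶠ zero    f = 0
countᶠ (suc n) f = bit (f zero) + countᶠ n (f ∘ suc)

any-cong : ∀ n {f g : Fin n → Bool} → (∀ i → f i ≡ g i) → anyᶠ n f ≡ anyᶠ n g
any-cong zero    h = refl
any-cong (suc n) h = cong₂ _∨_ (h zero) (any-cong n (h ∘ suc))

all-cong : ∀ n {f g : Fin n → Bool} → (∀ i → f i ≡ g i) → allᶠ n f ≡ allᶠ n g
all-cong zero    h = refl
all-cong (suc n) h = cong₂ _∧_ (h zero) (all-cong n (h ∘ suc))

count-cong : ∀ n {f g : Fin n → Bool} → (∀ i → f i ≡ g i) → countᶠ n f ≡ countᶠ n g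
count-cong zero    h = refl
count-cong (suc n) h = cong₂ (λ a k → bit a + k) (h zero) (count-cong n (h ∘ suc))

any-false : ∀ n → anyᶠ n (λ _ → false) ≡ false
any-false zero    = refl
any-false (suc n) = any-false n

all-true : ∀ n → allᶠ n (λ _ → true) ≡ true
all-true zero    = refl
all-true (suc n) = all-true n

count-false : ∀ n → countᶠ n (λ _ → false) ≡ 0
count-false zero    = refl
count-false (suc n) = count-false n

infix 4 _<ᶠ_

-- Recursive, so that `until` at `zero` and at `suc i` unfolds by computation to statements about
-- the remaining events.
_<ᶠ_ : ∀ {n} → Fin n → Fin n → Bool
_     <ᶠ zero  = false
zero  <ᶠ suc j = true
suc i <ᶠ suc j = i <ᶠ j

countC : ∀ n → ℕ → (time sub : Fin n → Bool) → Bool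
countC n c time sub = c ≤ᵇ countᶠ n (λ k → time k ∧ sub k)

until : ∀ n → Bool → ℕ → (time lhs mid rhs : Fin n → Bool) → Fin n → Bool
until n neg c time lhs mid rhs i = anyᶠ n λ j →
  (i <ᶠ j) ∧ rhs j ∧ time j ∧ allᶠ n (λ k → not ((i <ᶠ k) ∧ (k <ᶠ j)) ∨ lhs k) ∧
  (neg xor (c ≤ᵇ countᶠ n (λ k → ((i <ᶠ k) ∧ (k <ᶠ j)) ∧ mid k)))

countC-cong : ∀ n c time {sub sub′} → (∀ i → sub i ≡ sub′ i) → countC n c time sub ≡ countC n c time sub′
countC-cong n c time h = cong (c ≤ᵇ_) (count-cong n λ k → cong (time k ∧_) (h k))

until-cong : ∀ n neg c time {lhs lhs′ mid mid′ rhs rhs′} →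
  (∀ i → lhs i ≡ lhs′ i) → (∀ i → mid i ≡ mid′ i) → (∀ i → rhs i ≡ rhs′ i) → ∀ i →
  until n neg c time lhs mid rhs i ≡ until n neg c time lhs′ mid′ rhs′ i
until-cong n neg c time hl hm hr i = any-cong n λ j → cong ((i <ᶠ j) ∧_) (cong₂ _∧_ (hr j) (cong (time j ∧_)
  (cong₂ _∧_ (all-cong n λ k → cong (not ((i <ᶠ k) ∧ (k <ᶠ j)) ∨_) (hl k))
             (cong (λ x → neg xor (c ≤ᵇ x)) (count-cong n λ k → cong (((i <ᶠ k) ∧ (k <ᶠ j)) ∧_) (hm k))))))

module _ {p n : ℕ} (σ : Fin n → Subset p) (in? : Interval ℕ → Fin n → Fin n → Bool) where
  eval : Formula p → Fin n → Bool
  eval (prop a)                i = lookup (σ i) a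
  eval true                    i = true
  eval (φ ∧′ ψ)                i = eval φ i ∧ eval ψ i
  eval (¬′ φ)                  i = not (eval φ i)
  eval (C[ I ,≥ c ] φ)           i = countC n c (in? I i) (eval φ)
  eval (φ U[ I , # θ ≥ c ] ψ) i = until n false c (in? I i) (eval φ) (eval θ) (eval ψ) i
  eval (φ U[ I , # θ < c ] ψ) i = until n true c (in? I i) (eval φ) (eval θ) (eval ψ) i

-- Labels and the monitor of a formula

-- Only the truth values of temporal subformulas are guessed.

Label : ∀ {p} → Formula p → Set
Label (prop a)                = ⊤
Label true                    = ⊤
Label (φ ∧′ ψ)                = Label φ × Label ψ
Label (¬′ φ)                  = Label φ
Label (C[ I ,≥ c ] φ)           = Bool × Label φ
Label (φ U[ I , # θ ≥ c ] ψ) = Bool × Label φ × Label θ × Label ψ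
Label (φ U[ I , # θ < c ] ψ) = Bool × Label φ × Label θ × Label ψ

value : ∀ {p} (φ : Formula p) → Subset p → Label φ → Bool
value (prop a)                s l = lookup s a
value true                    s l = true
value (φ ∧′ ψ)                s l = value φ s (proj₁ l) ∧ value ψ s (proj₂ l)
value (¬′ φ)                  s l = not (value φ s l)
value (C[ I ,≥ c ] φ)           s l = proj₁ l
value (φ U[ I , # θ ≥ c ] ψ) s l = proj₁ l
value (φ U[ I , # θ < c ] ψ) s l = proj₁ l

bools : List Bool
bools = true ∷ false ∷ []

∈-bools : ∀ b → b ∈ bools
∈-bools true = here refl
∈-bools false     = there (here refl)

labels : ∀ {p} (φ : Formula p) → List (Label φ)
labels (prop a)                = tt ∷ []
labels true                    = tt ∷ []
labels (φ ∧′ ψ)                = cartesianProduct (labels φ) (labels ψ)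
labels (¬′ φ)                  = labels φ
labels (C[ I ,≥ c ] φ)           = cartesianProduct bools (labels φ)
labels (φ U[ I , # θ ≥ c ] ψ) =
  cartesianProduct bools (cartesianProduct (labels φ) (cartesianProduct (labels θ) (labels ψ)))
labels (φ U[ I , # θ < c ] ψ) =
  cartesianProduct bools (cartesianProduct (labels φ) (cartesianProduct (labels θ) (labels ψ)))

∈-labels : ∀ {p} (φ : Formula p) l → l ∈ labels φ
∈-labels (prop a) tt = here refl
∈-labels true     tt = here refl
∈-labels (φ ∧′ ψ) (l , m) = ∈-cartesianProduct⁺ (∈-labels φ l) (∈-labels ψ m)
∈-labels (¬′ φ) l = ∈-labels φ l
∈-labels (C[ I ,≥ c ] φ) (b , l) = ∈-cartesianProduct⁺ (∈-bools b) (∈-labels φ l)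
∈-labels (φ U[ I , # θ ≥ c ] ψ) (b , l , m , r) =
  ∈-cartesianProduct⁺ (∈-bools b) (∈-cartesianProduct⁺ (∈-labels φ l) (∈-cartesianProduct⁺ (∈-labels θ m) (∈-labels ψ r)))
∈-labels (φ U[ I , # θ < c ] ψ) (b , l , m , r) =
  ∈-cartesianProduct⁺ (∈-bools b) (∈-cartesianProduct⁺ (∈-labels φ l) (∈-cartesianProduct⁺ (∈-labels θ m) (∈-labels ψ r)))

truth : ∀ {p n} (σ : Fin n → Subset p) (in? : Interval ℕ → Fin n → Fin n → Bool) (φ : Formula p) → Fin n → Label φ
truth σ in? (prop a)                 i = tt
truth σ in? true                     i = tt
truth σ in? (φ ∧′ ψ)                 i = truth σ in? φ i , truth σ in? ψ i
truth σ in? (¬′ φ)                   i = truth σ in? φ i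
truth σ in? χ@(C[ I ,≥ c ] φ)        i = eval σ in? χ i , truth σ in? φ i
truth σ in? χ@(φ U[ I , # θ ≥ c ] ψ) i = eval σ in? χ i , truth σ in? φ i , truth σ in? θ i , truth σ in? ψ i
truth σ in? χ@(φ U[ I , # θ < c ] ψ) i = eval σ in? χ i , truth σ in? φ i , truth σ in? θ i , truth σ in? ψ i

value-truth : ∀ {p n} (τ : Fin n → Subset p) in? φ i → value φ (τ i) (truth τ in? φ i) ≡ eval τ in? φ i
value-truth τ in? (prop a)               i = refl
value-truth τ in? true                   i = refl
value-truth τ in? (φ ∧′ ψ)               i = cong₂ _∧_ (value-truth τ in? φ i) (value-truth τ in? ψ i)
value-truth τ in? (¬′ φ)                 i = cong not (value-truth τ in? φ i)
value-truth τ in? (C[ I ,≥ c ] φ)        i = refl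
value-truth τ in? (φ U[ I , # θ ≥ c ] ψ) i = refl
value-truth τ in? (φ U[ I , # θ < c ] ψ) i = refl

-- `σ` and `l` extract from a letter what the subformula needs, so the monitors of all subformulas
-- read one common alphabet.
monitor : ∀ {p A} (φ : Formula p) (σ : A → Subset p) (l : A → Label φ) → Monitor A
monitor (prop a) σ l = unit
monitor true     σ l = unit
monitor (φ ∧′ ψ) σ l = monitor φ σ (proj₁ ∘ l) ⊗ monitor ψ σ (proj₂ ∘ l)
monitor (¬′ φ)   σ l = monitor φ σ l
monitor (C[ I ,≥ c ] φ) σ l =
  cMonitor I c (proj₁ ∘ l) (λ a → value φ (σ a) (proj₂ (l a))) ⊗ monitor φ σ (proj₂ ∘ l)
monitor (φ U[ I , # θ ≥ c ] ψ) σ l =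
  uMonitor I false c (proj₁ ∘ l) (λ a → value φ (σ a) (proj₁ (proj₂ (l a))))
    (λ a → value θ (σ a) (proj₁ (proj₂ (proj₂ (l a)))))
    (λ a → value ψ (σ a) (proj₂ (proj₂ (proj₂ (l a))))) ⊗
  monitor φ σ (proj₁ ∘ proj₂ ∘ l) ⊗ monitor θ σ (proj₁ ∘ proj₂ ∘ proj₂ ∘ l) ⊗
  monitor ψ σ (proj₂ ∘ proj₂ ∘ proj₂ ∘ l)
monitor (φ U[ I , # θ < c ] ψ) σ l =
  uMonitor I true c (proj₁ ∘ l) (λ a → value φ (σ a) (proj₁ (proj₂ (l a))))
    (λ a → value θ (σ a) (proj₁ (proj₂ (proj₂ (l a)))))
    (λ a → value ψ (σ a) (proj₂ (proj₂ (proj₂ (l a))))) ⊗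
  monitor φ σ (proj₁ ∘ proj₂ ∘ l) ⊗ monitor θ σ (proj₁ ∘ proj₂ ∘ proj₂ ∘ l) ⊗
  monitor ψ σ (proj₂ ∘ proj₂ ∘ proj₂ ∘ l)

-- Good words carry exactly the true labels

module _ {A : Set} (N : ℕ) (0<N : 0 < N) where
  open Ticks N

  private
    module G (M : Monitor A) = Checks M N

  Good₀ : Monitor A → ∀ n → ℕ → Events A n → Set
  Good₀ M n t e = Checks.Good M N (Monitor.k₀ M) t n e

  module _ (M M′ : Monitor A) where
    private
      module M = Monitor M
      module M′ = Monitor M′

    fold-⊗ : ∀ b s s′ n (e : Events A n) →
      G.fold (M ⊗ M′) b (s , s′) n e ≡ (G.fold M b s n e , G.fold M′ b s′ n e)
    fold-⊗ b s s′ zero    e = refl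
    fold-⊗ b s s′ (suc n) e = fold-⊗ b _ _ n (e ∘ suc)

    private
      good-⊗-suc : ∀ l l′ a t n (e : Events A n) →
        G.Good (M ⊗ M′) (l , l′) t n e ⇔ (G.Good M l t n e × G.Good M′ l′ t n e) →
        (Monitor.Acc (M ⊗ M′) (G.fold (M ⊗ M′) t (M.spawn l a , M′.spawn l′ a) n e) ×
         G.Good (M ⊗ M′) (l , l′) t n e) ⇔
        ((M.Acc (G.fold M t (M.spawn l a) n e) × G.Good M l t n e) ×
         (M′.Acc (G.fold M′ t (M′.spawn l′ a) n e) × G.Good M′ l′ t n e))
      good-⊗-suc l l′ a t n e IH rewrite fold-⊗ t (M.spawn l a) (M′.spawn l′ a) n e = mk⇔
        (λ ((a₁ , a₂) , g) → let (g₁ , g₂) = Equivalence.to IH g in (a₁ , g₁) , (a₂ , g₂))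
        (λ ((a₁ , g₁) , (a₂ , g₂)) → (a₁ , a₂) , Equivalence.from IH (g₁ , g₂))

    good-⊗ : ∀ k k′ t n (e : Events A n) →
      G.Good (M ⊗ M′) (k , k′) t n e ⇔ (G.Good M k t n e × G.Good M′ k′ t n e)
    good-⊗ k k′ t zero    e = mk⇔ (λ _ → tt , tt) (λ _ → tt)
    good-⊗ k k′ t (suc n) e with t ≡ᵇ proj₂ (e zero)
    ... | true = good-⊗-suc _ _ _ _ n (e ∘ suc) (good-⊗ _ _ _ n (e ∘ suc))
    ... | false     = good-⊗-suc _ _ _ _ n (e ∘ suc) (good-⊗ _ _ _ n (e ∘ suc))

  good-unit : ∀ t n (e : Events A n) → G.Good unit tt t n e
  good-unit t zero    e = tt
  good-unit t (suc n) e = tt , good-unit _ n (e ∘ suc)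

  increasing-≤ : ∀ {t n} {e : Events A n} → Increasing t n e → ∀ i → t ≤ proj₂ (e i)
  increasing-≤ (l , _) zero    = l
  increasing-≤ (l , i) (suc j) = ℕ.≤-trans l (increasing-≤ i j)

  module _ (I : Interval ℕ) (c : ℕ) (out sub : A → Bool) where
    private
      M = cMonitor I c out sub

    fold-c : ∀ b o x n (e : Events A n) →
      G.fold M b (o , x) n e ≡ (o , x + countᶠ n (λ k → inᵀ b (proj₂ (e k)) I ∧ sub (proj₁ (e k))))
    fold-c b o x zero    e = cong (o ,_) (sym (ℕ.+-identityʳ x))
    fold-c b o x (suc n) e = trans (fold-c b o _ n (e ∘ suc)) (cong (o ,_) (ℕ.+-assoc x _ _))

    private
      in-now : ∀ t → inᴬ true 0 I ≡ inᵀ t t I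
      in-now t = trans (sym (in-head 0<N t 0 I)) (cong (λ u → inᵀ t u I) (ℕ.+-identityʳ t))

      -- Interval bounds are nonnegative, so a strictly earlier event is never counted. This is why
      -- the counter may be reset when time elapses.
      in-past : ∀ J {t t′} → t′ < t → inᵀ t t′ J ≡ false
      in-past (([ a) ,, u) {t} {t′} l = cong (_∧ belowᵀ u t t′) (>⇒≤ᵇ≡false (ℕ.<-≤-trans l (ℕ.m≤m+n _ _)))
      in-past ((⦅ a) ,, u) {t} {t′} l =
        cong (_∧ belowᵀ u t t′) (>⇒≤ᵇ≡false (ℕ.≤-trans l (ℕ.≤-trans (ℕ.m≤m+n _ (a * N)) (ℕ.n≤1+n _))))

      -- k is the number of past events at time t₀ that count when 0 ∈ I; such
      -- events count for a later event only if that event is at time t₀ as well.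
      counter : ∀ x k {t₀ t t′} → t₀ ≤ t → t ≤ t′ →
        (if t ≡ᵇ t′ then (if t₀ ≡ᵇ t then k else 0) + bit (inᴬ true 0 I ∧ x) else 0) ≡
        (if t₀ ≡ᵇ t′ then k else 0) + bit (inᵀ t′ t I ∧ x)
      counter x k {t₀} {t} {t′} l l′ with ℕ.m≤n⇒m<n∨m≡n l′
      ... | inj₂ refl rewrite ≡ᵇ-refl t | in-now t = refl
      ... | inj₁ l″ rewrite ≢⇒≡ᵇ≡false (ℕ.<⇒≢ l″)
                          | ≢⇒≡ᵇ≡false (ℕ.<⇒≢ (ℕ.≤-<-trans l l″)) | in-past I l″ = refl

    private
      Counted : ℕ → ℕ → ∀ n → Events A n → Set
      Counted k t n e = ∀ i → out (proj₁ (e i)) ≡ (c ≤ᵇ ((if t ≡ᵇ proj₂ (e i) then k else 0) +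
        countᶠ n (λ j → inᵀ (proj₂ (e i)) (proj₂ (e j)) I ∧ sub (proj₁ (e j)))))

      -- The induction no longer sees events already read, hence the arbitrary counter value `k`. In
      -- `rest` the contribution of the first event moves from the counter into the count over all
      -- events.
      good-c′ : ∀ k t n (e : Events A n) → Increasing t n e → G.Good M k t n e ⇔ Counted k t n e
      good-c′ k t zero    e _        = mk⇔ (λ _ ()) (λ _ → tt)
      good-c′ k t (suc n) e (l , ls) = mk⇔
        (λ { (acc , g) zero    → trans acc′ (trans acc (cong (c ≤ᵇ_) first))
           ; (acc , g) (suc i) → trans (Equivalence.to IH g i) (cong (c ≤ᵇ_) (rest i)) })
        (λ h → trans (sym acc′) (trans (h zero) (cong (c ≤ᵇ_) (sym first))) ,
               Equivalence.from IH λ i → trans (h (suc i)) (cong (c ≤ᵇ_) (sym (rest i))))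
        where
        t′ = proj₂ (e zero)
        a = proj₁ (e zero)
        k′ = (if t ≡ᵇ t′ then k else 0) + bit (inᴬ true 0 I ∧ sub a)
        IH = good-c′ k′ t′ n (e ∘ suc) ls
        final = fold-c t′ (out a) k′ n (e ∘ suc)
        acc′ : out a ≡ proj₁ (G.fold M t′ (out a , k′) n (e ∘ suc))
        acc′ = sym (cong proj₁ final)
        first : proj₂ (G.fold M t′ (out a , k′) n (e ∘ suc)) ≡ (if t ≡ᵇ t′ then k else 0) +
          countᶠ (suc n) (λ j → inᵀ t′ (proj₂ (e j)) I ∧ sub (proj₁ (e j)))
        first = trans (cong proj₂ final) (trans
          (ℕ.+-assoc (if t ≡ᵇ t′ then k else 0) _ _)
          (cong (λ z → (if t ≡ᵇ t′ then k else 0) + (bit (z ∧ sub a) +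
             countᶠ n (λ j → inᵀ t′ (proj₂ (e (suc j))) I ∧ sub (proj₁ (e (suc j)))))) (in-now t′)))
        rest : ∀ i → let t″ = proj₂ (e (suc i)) in
          (if t′ ≡ᵇ t″ then k′ else 0) + countᶠ n (λ j → inᵀ t″ (proj₂ (e (suc j))) I ∧ sub (proj₁ (e (suc j)))) ≡
          (if t ≡ᵇ t″ then k else 0) + countᶠ (suc n) (λ j → inᵀ t″ (proj₂ (e j)) I ∧ sub (proj₁ (e j)))
        rest i = trans (cong (_+ _) (counter (sub a) k l (increasing-≤ ls i)))
          (ℕ.+-assoc (if t ≡ᵇ proj₂ (e (suc i)) then k else 0) _ _)

    good-c : ∀ {t n} {e : Events A n} → Increasing t n e → G.Good M 0 t n e ⇔
      (∀ i → out (proj₁ (e i)) ≡ countC n c (λ j → inᵀ (proj₂ (e i)) (proj₂ (e j)) I) (sub ∘ proj₁ ∘ e))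
    good-c {t} {n} {e} inc = mk⇔ (λ g i → trans (Equivalence.to E g i) (cong (c ≤ᵇ_) (zero₀ i)))
                                 (λ h → Equivalence.from E λ i → trans (h i) (cong (c ≤ᵇ_) (sym (zero₀ i))))
      where
      E = good-c′ 0 t n e inc
      zero₀ : ∀ i {x} → (if t ≡ᵇ proj₂ (e i) then 0 else 0) + x ≡ x
      zero₀ i with t ≡ᵇ proj₂ (e i)
      ... | true = refl
      ... | false     = refl

  module _ (I : Interval ℕ) (neg : Bool) (c : ℕ) (out lhs mid rhs : A → Bool) where
    private
      M = uMonitor I neg c out lhs mid rhs

      thr : ℕ → Bool
      thr x = neg xor (c ≤ᵇ x)

      -- What a live token still expects: `until` over the unread events, with `x` middle events
      -- already counted.
      ahead : ℕ → ℕ → ∀ n → Events A n → Bool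
      ahead b x n e = anyᶠ n λ j → rhs (proj₁ (e j)) ∧ inᵀ b (proj₂ (e j)) I ∧
        allᶠ n (λ k → not (k <ᶠ j) ∨ lhs (proj₁ (e k))) ∧ thr (x + countᶠ n (λ k → (k <ᶠ j) ∧ mid (proj₁ (e k))))

      pull : ∀ n l (r m a t : Fin n → Bool) →
        anyᶠ n (λ j → r j ∧ m j ∧ (l ∧ a j) ∧ t j) ≡ l ∧ anyᶠ n (λ j → r j ∧ m j ∧ a j ∧ t j)
      pull n true r m a t = refl
      pull n false r m a t =
        trans (any-cong n λ j → trans (cong (r j ∧_) (Bool.∧-zeroʳ (m j))) (Bool.∧-zeroʳ (r j))) (any-false n)

      ahead-suc : ∀ b x n e → ahead b x (suc n) e ≡
        (rhs (proj₁ (e zero)) ∧ inᵀ b (proj₂ (e zero)) I ∧ thr x) ∨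
        (lhs (proj₁ (e zero)) ∧ ahead b (x + bit (mid (proj₁ (e zero)))) n (e ∘ suc))
      ahead-suc b x n e = cong₂ _∨_
        (cong (λ z → rhs (proj₁ (e zero)) ∧ inᵀ b (proj₂ (e zero)) I ∧ z)
          (cong₂ _∧_ (all-true n) (cong thr (trans (cong (x +_) (count-false n)) (ℕ.+-identityʳ x)))))
        (trans (pull n (lhs (proj₁ (e zero))) (rhs ∘ proj₁ ∘ e ∘ suc) (λ j → inᵀ b (proj₂ (e (suc j))) I)
            (λ j → allᶠ n (λ k → not (k <ᶠ j) ∨ lhs (proj₁ (e (suc k))))) _)
          (cong (lhs (proj₁ (e zero)) ∧_) (any-cong n λ j → cong (λ z → rhs (proj₁ (e (suc j))) ∧ inᵀ b (proj₂ (e (suc j))) I ∧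
            allᶠ n (λ k → not (k <ᶠ j) ∨ lhs (proj₁ (e (suc k)))) ∧ thr z) (sym (ℕ.+-assoc x _ _)))))

      regroup : ∀ w al l q r → (w ∨ (al ∧ q)) ∨ ((al ∧ l) ∧ r) ≡ w ∨ (al ∧ (q ∨ (l ∧ r)))
      regroup true  al         l q r = refl
      regroup false      true  l q r = refl
      regroup false      false      l q r = refl

      open UState

      fold-label : ∀ b s n (e : Events A n) → label (G.fold M b s n e) ≡ label s
      fold-label b s zero    e = refl
      fold-label b s (suc n) e = fold-label b _ n (e ∘ suc)

      fold-won : ∀ b o al w x n (e : Events A n) →
        won (G.fold M b (ustate o al w x) n e) ≡ w ∨ (al ∧ ahead b x n e)
      fold-won b o al w x zero    e = sym (trans (cong (w ∨_) (Bool.∧-zeroʳ al)) (Bool.∨-identityʳ w))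
      fold-won b o al w x (suc n) e = trans (fold-won b o _ _ _ n (e ∘ suc))
        (trans (regroup w al (lhs (proj₁ (e zero))) _ _) (cong (λ z → w ∨ (al ∧ z)) (sym (ahead-suc b x n e))))

    good-u : ∀ t n (e : Events A n) → G.Good M tt t n e ⇔
      (∀ i → out (proj₁ (e i)) ≡ until n neg c (λ j → inᵀ (proj₂ (e i)) (proj₂ (e j)) I)
                                   (lhs ∘ proj₁ ∘ e) (mid ∘ proj₁ ∘ e) (rhs ∘ proj₁ ∘ e) i)
    good-u t zero    e = mk⇔ (λ _ ()) (λ _ → tt)
    good-u t (suc n) e = mk⇔
      (λ { (acc , g) zero    → trans (sym (fold-label _ _ n (e ∘ suc))) (trans acc (fold-won _ _ _ _ _ n (e ∘ suc)))
         ; (acc , g) (suc i) → Equivalence.to IH g i })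
      (λ h → trans (fold-label _ _ n (e ∘ suc)) (trans (h zero) (sym (fold-won _ _ _ _ _ n (e ∘ suc)))) ,
             Equivalence.from IH (h ∘ suc))
      where IH = good-u (proj₂ (e zero)) n (e ∘ suc)

  module _ {p : ℕ} where
    times : ∀ {n} → Events A n → Interval ℕ → Fin n → Fin n → Bool
    times e I i j = inᵀ (proj₂ (e i)) (proj₂ (e j)) I

    meaning : ∀ (σ : A → Subset p) {n} (e : Events A n) → Formula p → Fin n → Bool
    meaning σ e = eval (σ ∘ proj₁ ∘ e) (times e)

    private
      count-good : ∀ I c out sub (M : Monitor A) {t n} {e : Events A n} {S : Fin n → Bool} → Increasing t n e →
        (∀ i → sub (proj₁ (e i)) ≡ S i) →
        Good₀ (cMonitor I c out sub ⊗ M) n t e ⇔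
        ((∀ i → out (proj₁ (e i)) ≡ countC n c (times e I i) S) × Good₀ M n t e)
      count-good I c out sub M {t} {n} {e} inc h = mk⇔
        (λ g → let (g₁ , g₂) = split .to g in (λ i → trans (good-c I c out sub inc .to g₁ i) (same i)) , g₂)
        (λ (o , g) → split .from (good-c I c out sub inc .from (λ i → trans (o i) (sym (same i))) , g))
        where
        open Equivalence
        split = good-⊗ (cMonitor I c out sub) M _ _ t n e
        same = λ i → countC-cong n c (times e I i) h

      until-good : ∀ I neg c out lhs mid rhs (L M R : Monitor A) {t n} {e : Events A n} {l m r : Fin n → Bool} →
        (∀ i → out (proj₁ (e i)) ≡ until n neg c (times e I i) l m r i) →
        (∀ i → lhs (proj₁ (e i)) ≡ l i) → (∀ i → mid (proj₁ (e i)) ≡ m i) →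
        (∀ i → rhs (proj₁ (e i)) ≡ r i) →
        Good₀ L n t e → Good₀ M n t e → Good₀ R n t e →
        Good₀ (uMonitor I neg c out lhs mid rhs ⊗ L ⊗ M ⊗ R) n t e
      until-good I neg c out lhs mid rhs L M R {t} {n} {e} o hl hm hr gl gm gr =
        good-⊗ U (L ⊗ M ⊗ R) _ _ t n e .from
          ( good-u I neg c out lhs mid rhs t n e .from
              (λ i → trans (o i) (sym (until-cong n neg c (times e I i) hl hm hr i)))
          , good-⊗ L (M ⊗ R) _ _ t n e .from (gl , good-⊗ M R _ _ t n e .from (gm , gr)))
        where
        open Equivalence
        U = uMonitor I neg c out lhs mid rhs

      good-until : ∀ I neg c out lhs mid rhs (L M R : Monitor A) {t n} {e : Events A n} {l m r : Fin n → Bool} →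
        (Good₀ L n t e → ∀ i → lhs (proj₁ (e i)) ≡ l i) →
        (Good₀ M n t e → ∀ i → mid (proj₁ (e i)) ≡ m i) →
        (Good₀ R n t e → ∀ i → rhs (proj₁ (e i)) ≡ r i) →
        Good₀ (uMonitor I neg c out lhs mid rhs ⊗ L ⊗ M ⊗ R) n t e →
        ∀ i → out (proj₁ (e i)) ≡ until n neg c (times e I i) l m r i
      good-until I neg c out lhs mid rhs L M R {t} {n} {e} hl hm hr g i =
        let (gu , g′) = good-⊗ U (L ⊗ M ⊗ R) _ _ t n e .to g
            (gl , g″) = good-⊗ L (M ⊗ R) _ _ t n e .to g′
            (gm , gr) = good-⊗ M R _ _ t n e .to g″
        in trans (good-u I neg c out lhs mid rhs t n e .to gu i)
                 (until-cong n neg c (times e I i) (hl gl) (hm gm) (hr gr) i)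
        where
        open Equivalence
        U = uMonitor I neg c out lhs mid rhs

    -- By induction the guessed values of the immediate subformulas are correct. Tokens compute from
    -- these values, so their acceptance equates each label with the true verdict.
    good⇒value : ∀ φ (σ : A → Subset p) (l : A → Label φ) {t n} {e : Events A n} → Increasing t n e →
      Good₀ (monitor φ σ l) n t e → ∀ i → value φ (σ (proj₁ (e i))) (l (proj₁ (e i))) ≡ meaning σ e φ i
    good⇒value (prop a) σ l inc g i = refl
    good⇒value true     σ l inc g i = refl
    good⇒value (φ ∧′ ψ) σ l {t} {n} {e} inc g i =
      let (g₁ , g₂) = Equivalence.to (good-⊗ (monitor φ σ _) (monitor ψ σ _) _ _ t n e) g
      in cong₂ _∧_ (good⇒value φ σ _ inc g₁ i) (good⇒value ψ σ _ inc g₂ i)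
    good⇒value (¬′ φ) σ l inc g i = cong not (good⇒value φ σ l inc g i)
    good⇒value (C[ I ,≥ c ] φ) σ l {t} {n} {e} inc g =
      proj₁ (Equivalence.to (count-good I c _ _ M inc (good⇒value φ σ (proj₂ ∘ l) inc g₂)) g)
      where
      M = monitor φ σ (proj₂ ∘ l)
      g₂ = proj₂ (Equivalence.to (good-⊗ (cMonitor I c _ _) M _ _ t n e) g)
    good⇒value (φ U[ I , # θ ≥ c ] ψ) σ l inc = good-until I false c _ _ _ _ _ _ _
      (good⇒value φ σ _ inc) (good⇒value θ σ _ inc) (good⇒value ψ σ _ inc)
    good⇒value (φ U[ I , # θ < c ] ψ) σ l inc = good-until I true c _ _ _ _ _ _ _
      (good⇒value φ σ _ inc) (good⇒value θ σ _ inc) (good⇒value ψ σ _ inc)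

    private
      holds : ∀ φ (σ : A → Subset p) (l : A → Label φ) {n} {e : Events A n} →
              (∀ i → l (proj₁ (e i)) ≡ truth (σ ∘ proj₁ ∘ e) (times e) φ i) →
              ∀ i → value φ (σ (proj₁ (e i))) (l (proj₁ (e i))) ≡ meaning σ e φ i
      holds φ σ l {e = e} h i = trans (cong (value φ _) (h i)) (value-truth (σ ∘ proj₁ ∘ e) (times e) φ i)

    truth⇒good : ∀ φ (σ : A → Subset p) (l : A → Label φ) {t n} {e : Events A n} → Increasing t n e →
      (∀ i → l (proj₁ (e i)) ≡ truth (σ ∘ proj₁ ∘ e) (times e) φ i) → Good₀ (monitor φ σ l) n t e
    truth⇒good (prop a) σ l {t} {n} {e} inc h = good-unit t n e
    truth⇒good true     σ l {t} {n} {e} inc h = good-unit t n e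
    truth⇒good (φ ∧′ ψ) σ l {t} {n} {e} inc h =
      Equivalence.from (good-⊗ (monitor φ σ _) (monitor ψ σ _) _ _ t n e)
        (truth⇒good φ σ _ inc (cong proj₁ ∘ h) , truth⇒good ψ σ _ inc (cong proj₂ ∘ h))
    truth⇒good (¬′ φ) σ l inc h = truth⇒good φ σ l inc h
    truth⇒good (C[ I ,≥ c ] φ) σ l inc h =
      Equivalence.from (count-good I c _ _ _ inc (holds φ σ (proj₂ ∘ l) (cong proj₂ ∘ h)))
        (cong proj₁ ∘ h , truth⇒good φ σ _ inc (cong proj₂ ∘ h))
    truth⇒good (φ U[ I , # θ ≥ c ] ψ) σ l inc h = until-good I false c _ _ _ _ _ _ _
      (cong proj₁ ∘ h) (holds φ σ (proj₁ ∘ proj₂ ∘ l) h₁) (holds θ σ (proj₁ ∘ proj₂ ∘ proj₂ ∘ l) h₂)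
      (holds ψ σ (proj₂ ∘ proj₂ ∘ proj₂ ∘ l) h₃)
      (truth⇒good φ σ _ inc h₁) (truth⇒good θ σ _ inc h₂) (truth⇒good ψ σ _ inc h₃)
      where
      h₁ = cong (proj₁ ∘ proj₂) ∘ h
      h₂ = cong (proj₁ ∘ proj₂ ∘ proj₂) ∘ h
      h₃ = cong (proj₂ ∘ proj₂ ∘ proj₂) ∘ h
    truth⇒good (φ U[ I , # θ < c ] ψ) σ l inc h = until-good I true c _ _ _ _ _ _ _
      (cong proj₁ ∘ h) (holds φ σ (proj₁ ∘ proj₂ ∘ l) h₁) (holds θ σ (proj₁ ∘ proj₂ ∘ proj₂ ∘ l) h₂)
      (holds ψ σ (proj₂ ∘ proj₂ ∘ proj₂ ∘ l) h₃)
      (truth⇒good φ σ _ inc h₁) (truth⇒good θ σ _ inc h₂) (truth⇒good ψ σ _ inc h₃)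
      where
      h₁ = cong (proj₁ ∘ proj₂) ∘ h
      h₂ = cong (proj₁ ∘ proj₂ ∘ proj₂) ∘ h
      h₃ = cong (proj₂ ∘ proj₂ ∘ proj₂) ∘ h

-- Boolean evaluation reflects satisfaction

infix 3 _reflects_

_reflects_ : Bool → Set → Set
b reflects P = P ⇔ b ≡ true

reflects-∧ : ∀ {a b P Q} → a reflects P → b reflects Q → (a ∧ b) reflects (P × Q)
reflects-∧ {true} {b} h k = mk⇔ (k .to ∘ proj₂) (λ e → h .from refl , k .from e)
reflects-∧ {false}     {b} h k = mk⇔ (h .to ∘ proj₁) λ ()

reflects-¬ : ∀ {a P} → a reflects P → not a reflects (¬ P)
reflects-¬ {true} h = mk⇔ (λ ¬p → ⊥-elim (¬p (h .from refl))) λ ()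
reflects-¬ {false}     h = mk⇔ (λ _ → refl) λ _ p → Bool.not-¬ refl (h .to p)

reflects-→ : ∀ {a b P Q} → a reflects P → b reflects Q → (not a ∨ b) reflects (P → Q)
reflects-→ {true} h k = mk⇔ (λ f → k .to (f (h .from refl))) (λ e _ → k .from e)
reflects-→ {false}     h k = mk⇔ (λ _ → refl) λ _ p → ⊥-elim (Bool.not-¬ refl (h .to p))

reflects-any : ∀ n {f : Fin n → Bool} {P : Fin n → Set} → (∀ i → f i reflects P i) → anyᶠ n f reflects ∃ P
reflects-any zero    h = mk⇔ (λ ()) λ ()
reflects-any (suc n) {f} {P} h with f zero | h zero
... | true | h₀ = mk⇔ (λ _ → refl) λ _ → zero , h₀ .from refl
... | false     | h₀ = mk⇔
  (λ { (zero , p) → ⊥-elim (Bool.not-¬ refl (h₀ .to p)) ; (suc i , p) → IH .to (i , p) })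
  (λ e → let (i , p) = IH .from e in suc i , p)
  where IH = reflects-any n (h ∘ suc)

reflects-all : ∀ n {f : Fin n → Bool} {P : Fin n → Set} → (∀ i → f i reflects P i) → allᶠ n f reflects (∀ i → P i)
reflects-all zero    h = mk⇔ (λ _ → refl) λ _ ()
reflects-all (suc n) h = mk⇔
  (λ p → both .to (p zero , p ∘ suc))
  (λ { e zero → proj₁ (both .from e) ; e (suc i) → proj₂ (both .from e) i })
  where both = reflects-∧ (h zero) (reflects-all n (h ∘ suc))

reflects-< : ∀ {n} (i j : Fin n) → (i <ᶠ j) reflects (i Fin.< j)
reflects-< i       zero    = mk⇔ (λ ()) λ ()
reflects-< zero    (suc j) = mk⇔ (λ _ → refl) λ _ → s≤s z≤n
reflects-< (suc i) (suc j) = mk⇔ (reflects-< i j .to ∘ ℕ.s≤s⁻¹) (s≤s ∘ reflects-< i j .from)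

reflects-≥ : ∀ c x → (c ≤ᵇ x) reflects (x ℕ.≥ c)
reflects-≥ c x = mk⇔ ≤⇒≤ᵇ≡true ≤ᵇ≡true⇒≤

reflects-<ᵗ : ∀ c x → not (c ≤ᵇ x) reflects (x ℕ.< c)
reflects-<ᵗ c x = mk⇔ (λ p → cong not (>⇒≤ᵇ≡false p))
  (λ e → ℕ.≰⇒> λ p → Bool.not-¬ refl (trans (sym (cong not (≤⇒≤ᵇ≡true p))) e))

card-count : ∀ {n} (K : Subset n) → ∣ K ∣ ≡ countᶠ n (lookup K)
card-count []                = refl
card-count (true ∷ K)  = cong suc (card-count K)
card-count (false ∷ K)      = card-count K

-- A subset with the prescribed extension is determined by `f`: any given `K` has the same
-- characteristic function, and `tabulate f` is one.
reflects-Card : ∀ n {f : Fin n → Bool} {P : Fin n → Set} {Q : ℕ → Set} {b : ℕ → Bool} →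
  (∀ i → f i reflects P i) → (∀ x → b x reflects Q x) → b (countᶠ n f) reflects Card P Q
reflects-Card n {f} {P} {Q} {b} h k = mk⇔
  (λ (K , K⇔ , q) → k _ .to (subst Q (trans (card-count K) (count-cong n λ i → same K (K⇔ i) (h i))) q))
  (λ e → tabulate f , (λ i → mk⇔ (λ m → h i .from (trans (sym (lookup∘tabulate f i)) ([]=⇒lookup m)))
                                 (λ p → lookup⇒[]= i _ (trans (lookup∘tabulate f i) (h i .to p)))) ,
     subst Q (sym (trans (card-count (tabulate f)) (count-cong n (lookup∘tabulate f)))) (k _ .from e))
  where
  same : ∀ (K : Subset n) {i P a} → (i ∈ˢ K) ⇔ P → a reflects P → lookup K i ≡ a
  same K {i} {a = true} e r = []=⇒lookup (e .from (r .from refl))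
  same K {i} {a = false}     e r = Bool.¬-not λ l → Bool.not-¬ refl (r .to (e .to (lookup⇒[]= i K l)))

-- The tick version of a real-timed word is arranged for finitely many constants only, hence the
-- restriction to intervals that occur in the formula.
AllIntervals : ∀ {p} → (Interval ℕ → Set) → Formula p → Set
AllIntervals P (prop a)                = ⊤
AllIntervals P true                    = ⊤
AllIntervals P (φ ∧′ ψ)                = AllIntervals P φ × AllIntervals P ψ
AllIntervals P (¬′ φ)                  = AllIntervals P φ
AllIntervals P (C[ I ,≥ c ] φ)         = P I × AllIntervals P φ
AllIntervals P (φ U[ I , # θ ≥ c ] ψ) = P I × AllIntervals P φ × AllIntervals P θ × AllIntervals P ψ
AllIntervals P (φ U[ I , # θ < c ] ψ) = P I × AllIntervals P φ × AllIntervals P θ × AllIntervals P ψ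

all-intervals : ∀ {p} {P : Interval ℕ → Set} → (∀ I → P I) → (φ : Formula p) → AllIntervals P φ
all-intervals h (prop a)               = tt
all-intervals h true                   = tt
all-intervals h (φ ∧′ ψ)               = all-intervals h φ , all-intervals h ψ
all-intervals h (¬′ φ)                 = all-intervals h φ
all-intervals h (C[ I ,≥ c ] φ)        = h I , all-intervals h φ
all-intervals h (φ U[ I , # θ ≥ c ] ψ) = h I , all-intervals h φ , all-intervals h θ , all-intervals h ψ
all-intervals h (φ U[ I , # θ < c ] ψ) = h I , all-intervals h φ , all-intervals h θ , all-intervals h ψ

module _ {p n} (ρ : TimedWord p n) (in? : Interval ℕ → Fin n → Fin n → Bool) where
  -- Counting tests membership in a translated interval, until tests a difference of times; one
  -- Boolean has to reflect both.
  Timing : Interval ℕ → Set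
  Timing I = ∀ i k → in? I i k reflects (τ ρ k ∈ᴵ τ ρ i +ᴵ I) × in? I i k reflects (τ ρ k -ᴿ τ ρ i ∈ᴵ ⟦ I ⟧ᴵ)

  private
    until-sat : ∀ I neg c (lhs mid rhs : Fin n → Bool) {L M R : Fin n → Set} {Q : ℕ → Set} → Timing I →
      (∀ k → lhs k reflects L k) → (∀ k → mid k reflects M k) → (∀ k → rhs k reflects R k) →
      (∀ x → (neg xor (c ≤ᵇ x)) reflects Q x) → ∀ i →
      until n neg c (in? I i) lhs mid rhs i reflects
      (∃[ j ] i Fin.< j × R j × τ ρ j -ᴿ τ ρ i ∈ᴵ ⟦ I ⟧ᴵ × (∀ k → i Fin.< k → k Fin.< j → L k) ×
        Card (λ k → i Fin.< k × k Fin.< j × M k) Q)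
    until-sat I neg c lhs mid rhs T hl hm hr hq i = reflects-any n λ j →
      reflects-∧ (reflects-< i j) (reflects-∧ (hr j) (reflects-∧ (proj₂ (T i j)) (reflects-∧
        (⇔-trans (mk⇔ (λ f k (l , l′) → f k l l′) (λ f k l l′ → f k (l , l′)))
          (reflects-all n λ k → reflects-→ (reflects-∧ (reflects-< i k) (reflects-< k j)) (hl k)))
        (reflects-Card n {b = λ x → neg xor (c ≤ᵇ x)}
          (λ k → ⇔-trans (mk⇔ (λ (l , l′ , m) → (l , l′) , m) (λ ((l , l′) , m) → l , l′ , m))
            (reflects-∧ (reflects-∧ (reflects-< i k) (reflects-< k j)) (hm k))) hq))))

  sat : ∀ φ → AllIntervals Timing φ → ∀ i → eval (σ ρ) in? φ i reflects (ρ , i ⊨ φ)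
  sat (prop a) _         i = mk⇔ []=⇒lookup (lookup⇒[]= a _)
  sat true     _         i = mk⇔ (λ _ → refl) (λ _ → tt)
  sat (φ ∧′ ψ) (t₁ , t₂) i = reflects-∧ (sat φ t₁ i) (sat ψ t₂ i)
  sat (¬′ φ)   t         i = reflects-¬ (sat φ t i)
  sat (C[ I ,≥ c ] φ) (T , t) i =
    reflects-Card n {b = c ≤ᵇ_} (λ k → reflects-∧ (proj₁ (T i k)) (sat φ t k)) (reflects-≥ c)
  sat (φ U[ I , # θ ≥ c ] ψ) (T , t₁ , t₂ , t₃) =
    until-sat I false c _ _ _ T (sat φ t₁) (sat θ t₂) (sat ψ t₃) (reflects-≥ c)
  sat (φ U[ I , # θ < c ] ψ) (T , t₁ , t₂ , t₃) =
    until-sat I true c _ _ _ T (sat φ t₁) (sat θ t₂) (sat ψ t₃) (reflects-<ᵗ c)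

-- Rationals and the order of Cauchy sequences

ι : ℕ → ℚ
ι k = ℤ.+ k ℚ./ 1

private
  ι-mkℚ : ∀ k → ι k ≡ mkℚ (ℤ.+ k) 0 (Coprime.sym (Coprime.1-coprimeTo k))
  ι-mkℚ k = ℚ.normalize-coprime (Coprime.sym (Coprime.1-coprimeTo k))

ι-+ : ∀ m n → ι (m ℕ.+ n) ≡ ι m ℚ.+ ι n
ι-+ m n rewrite ι-mkℚ m | ι-mkℚ n =
  cong (ℚ._/ 1) (trans (ℤ.pos-+ m n) (sym (cong₂ ℤ._+_ (ℤ.*-identityʳ (ℤ.+ m)) (ℤ.*-identityʳ (ℤ.+ n)))))

ι-* : ∀ m n → ι (m ℕ.* n) ≡ ι m ℚ.* ι n
ι-* m n rewrite ι-mkℚ m | ι-mkℚ n = cong (ℚ._/ 1) (ℤ.pos-* m n)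

ι-≤ : ∀ m n → m ℕ.≤ n ⇔ ι m ℚ.≤ ι n
ι-≤ m n rewrite ι-mkℚ m | ι-mkℚ n = mk⇔
  (λ l → *≤* (ℤ.*-monoʳ-≤-nonNeg (ℤ.+ 1) (+≤+ l)))
  (λ { (*≤* l) → ℤ.drop‿+≤+ (ℤ.*-cancelʳ-≤-pos (ℤ.+ m) (ℤ.+ n) (ℤ.+ 1) l) })

ι-pos : ∀ {n} → 0 ℕ.< n → Positive (ι n)
ι-pos {suc n} _ = subst Positive (sym (ι-mkℚ (suc n))) _

shift-≤ : ∀ {p q p′ q′} d → p ℚ.+ d ≡ p′ → q ℚ.+ d ≡ q′ → p ℚ.≤ q → p′ ℚ.≤ q′
shift-≤ d refl refl l = ℚ.+-monoˡ-≤ d l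

private
  ½-pos : ∀ {ε} → 0ℚ ℚ.< ε → 0ℚ ℚ.< ½ ℚ.* ε
  ½-pos {ε} l = ℚ.positive⁻¹ _ ⦃ ℚ.pos*pos⇒pos ½ ε ⦃ ℚ.positive l ⦄ ⦄

  halves : ∀ ε → ½ ℚ.* ε ℚ.+ ½ ℚ.* ε ≡ ε
  halves ε = trans (sym (ℚ.*-distribʳ-+ ε ½ ½)) (ℚ.*-identityˡ ε)

  p≤p+ε : ∀ p {ε} → 0ℚ ℚ.< ε → p ℚ.≤ p ℚ.+ ε
  p≤p+ε p {ε} l = subst (ℚ._≤ p ℚ.+ ε) (ℚ.+-identityʳ p) (ℚ.+-monoʳ-≤ p (ℚ.<⇒≤ l))

  p<p+ε : ∀ p {ε} → 0ℚ ℚ.< ε → p ℚ.< p ℚ.+ ε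
  p<p+ε p {ε} l = subst (ℚ._< p ℚ.+ ε) (ℚ.+-identityʳ p) (ℚ.+-monoʳ-< p l)

  p≤∣p∣ : ∀ p → p ℚ.≤ ℚ.∣ p ∣
  p≤∣p∣ p with 0ℚ ℚ.≤? p
  ... | yes l = ℚ.≤-reflexive (sym (ℚ.0≤p⇒∣p∣≡p l))
  ... | no ¬l = ℚ.≤-trans (ℚ.<⇒≤ (ℚ.≰⇒> ¬l)) (ℚ.0≤∣p∣ p)

  close : ∀ p q {ε} → ℚ.∣ p ℚ.- q ∣ ℚ.< ε → p ℚ.≤ q ℚ.+ ε
  close p q {ε} l = shift-≤ q
    (solve 2 (λ p q → (p :- q) :+ q := p) refl p q) (ℚ.+-comm ε q)
    (ℚ.≤-trans (p≤∣p∣ (p ℚ.- q)) (ℚ.<⇒≤ l))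

Seq : Set
Seq = ℕ → ℚ

infixl 6 _⊕_
infix 4 _≲_ _≪_ _≈_

_⊕_ : Seq → ℚ → Seq
(x ⊕ q) n = x n ℚ.+ q

-- _≤ᴿ_ and _<ᴿ_ for sequences that need not be Cauchy; these are records so that
-- x and y can be inferred.

record _≲_ (x y : Seq) : Set where
  constructor ≲-intro
  field ≲-elim : ∀ ε → 0ℚ ℚ.< ε → ∃[ N ] ∀ n → N ℕ.≤ n → x n ℚ.≤ y n ℚ.+ ε

record _≪_ (x y : Seq) : Set where
  constructor ≪-intro
  field ≪-elim : ∃[ ε ] 0ℚ ℚ.< ε × (∃[ N ] ∀ n → N ℕ.≤ n → x n ℚ.+ ε ℚ.≤ y n)

open _≲_
open _≪_

_≈_ : Seq → Seq → Set
x ≈ y = x ≲ y × y ≲ x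

≲⇔≤ᴿ : ∀ {x y} → seq x ≲ seq y ⇔ x ≤ᴿ y
≲⇔≤ᴿ = mk⇔ ≲-elim ≲-intro

≪⇔<ᴿ : ∀ {x y} → seq x ≪ seq y ⇔ x <ᴿ y
≪⇔<ᴿ = mk⇔ ≪-elim ≪-intro

private
  both : ∀ {P Q R : ℕ → Set} → (∀ n → P n → Q n → R n) →
         (∃[ N ] ∀ n → N ℕ.≤ n → P n) → (∃[ N ] ∀ n → N ℕ.≤ n → Q n) → ∃[ N ] ∀ n → N ℕ.≤ n → R n
  both f (M , p) (N , q) = M ⊔ N , λ n l → f n (p n (ℕ.m⊔n≤o⇒m≤o M N l)) (q n (ℕ.m⊔n≤o⇒n≤o M N l))

≲-map : ∀ {x y x′ y′ : Seq} → (∀ n ε → x n ℚ.≤ y n ℚ.+ ε → x′ n ℚ.≤ y′ n ℚ.+ ε) → x ≲ y → x′ ≲ y′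
≲-map f (≲-intro p) = ≲-intro λ ε l → let (N , h) = p ε l in N , λ n m → f n ε (h n m)

≲-refl : ∀ {x} → x ≲ x
≲-refl = ≲-intro λ ε l → 0 , λ n _ → p≤p+ε _ l

≲-trans : ∀ {x y z} → x ≲ y → y ≲ z → x ≲ z
≲-trans {x} {y} {z} (≲-intro p) (≲-intro q) = ≲-intro λ ε l →
  both (step ε) (p (½ ℚ.* ε) (½-pos l)) (q (½ ℚ.* ε) (½-pos l))
  where
  step : ∀ ε n → x n ℚ.≤ y n ℚ.+ ½ ℚ.* ε → y n ℚ.≤ z n ℚ.+ ½ ℚ.* ε → x n ℚ.≤ z n ℚ.+ ε
  step ε n a b = ℚ.≤-trans a (ℚ.≤-trans (ℚ.+-monoˡ-≤ (½ ℚ.* ε) b)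
    (ℚ.≤-reflexive (trans (ℚ.+-assoc (z n) _ _) (cong (z n ℚ.+_) (halves ε)))))

≪⇒≲ : ∀ {x y} → x ≪ y → x ≲ y
≪⇒≲ {x} {y} (≪-intro (δ , d , N , h)) = ≲-intro λ ε l → N , λ n m →
  ℚ.≤-trans (p≤p+ε (x n) d) (ℚ.≤-trans (h n m) (p≤p+ε (y n) l))

≪⇒¬≳ : ∀ {x y} → x ≪ y → ¬ y ≲ x
≪⇒¬≳ {x} {y} (≪-intro (ε , l , p)) (≲-intro q) with both step p (q (½ ℚ.* ε) (½-pos l))
  where
  step : ∀ n → x n ℚ.+ ε ℚ.≤ y n → y n ℚ.≤ x n ℚ.+ ½ ℚ.* ε → ⊥
  step n a b = ℚ.<-irrefl refl (ℚ.<-≤-trans (p<p+ε (x n ℚ.+ ½ ℚ.* ε) (½-pos l))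
    (ℚ.≤-trans (ℚ.≤-reflexive (trans (ℚ.+-assoc (x n) _ _) (cong (x n ℚ.+_) (halves ε)))) (ℚ.≤-trans a b)))
... | N , h = h N ℕ.≤-refl

≪-eventually : ∀ {x y z w} → z ≲ x → x ≪ y → y ≲ w → ∃[ N ] ∀ n → N ℕ.≤ n → z n ℚ.< w n
≪-eventually {x} {y} {z} {w} (≲-intro p) (≪-intro (ε , l , q)) (≲-intro r) =
  both (λ n → step n) (both (λ _ → _,_) (p d (½-pos (½-pos l))) q) (r d (½-pos (½-pos l)))
  where
  h = ½ ℚ.* ε
  -- Each of the two `≲` costs a quarter of `ε`, so half of `ε` remains as the gap.
  d = ½ ℚ.* h
  step : ∀ n → z n ℚ.≤ x n ℚ.+ d × x n ℚ.+ ε ℚ.≤ y n → y n ℚ.≤ w n ℚ.+ d → z n ℚ.< w n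
  step n (a , b) c = ℚ.<-≤-trans (p<p+ε (z n) (½-pos l)) (shift-≤ (ℚ.- d)
    (solve 3 (λ z h d → ((z :+ d) :+ h) :- d := z :+ h) refl (z n) h d)
    (solve 2 (λ w d → (w :+ d) :- d := w) refl (w n) d)
    (ℚ.≤-trans (ℚ.+-monoˡ-≤ h (ℚ.+-monoˡ-≤ d a)) (ℚ.≤-trans (ℚ.≤-reflexive eq) (ℚ.≤-trans b c))))
    where
    eq : x n ℚ.+ d ℚ.+ d ℚ.+ h ≡ x n ℚ.+ ε
    eq = trans (solve 3 (λ x d h → ((x :+ d) :+ d) :+ h := x :+ ((d :+ d) :+ h)) refl (x n) d h)
               (cong (x n ℚ.+_) (trans (cong (ℚ._+ h) (halves h)) (halves ε)))

-- A single rational comparison at an index `K` beyond both Cauchy moduli decides the matter. If `y`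
-- exceeds `x` there by more than `ε / 2`, a gap of `ε / 4` persists, contrary to the assumption;
-- otherwise `y` stays within `ε` above `x`. Moving between indices costs `ε / 8` each time.
≮ᴿ⇒≥ᴿ : ∀ x y → ¬ x <ᴿ y → y ≤ᴿ x
≮ᴿ⇒≥ᴿ x y ¬p ε l with cauchy x d (½-pos (½-pos (½-pos l))) | cauchy y d (½-pos (½-pos (½-pos l)))
  where d = ½ ℚ.* (½ ℚ.* (½ ℚ.* ε))
... | M , cx | N , cy = go (seq y K ℚ.≤? seq x K ℚ.+ h)
  where
  h = ½ ℚ.* ε
  g = ½ ℚ.* h
  d = ½ ℚ.* g
  K = M ⊔ N
  M≤K = ℕ.m≤m⊔n M N
  N≤K = ℕ.m≤n⊔m M N
  dd : d ℚ.+ d ≡ g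
  dd = halves g
  go : Dec (seq y K ℚ.≤ seq x K ℚ.+ h) → ∃[ N ] ∀ n → N ℕ.≤ n → seq y n ℚ.≤ seq x n ℚ.+ ε
  go (yes a) = K , λ n m → let
      m₁ = ℕ.≤-trans M≤K m
      m₂ = ℕ.≤-trans N≤K m
    in begin
      seq y n                             ≤⟨ close (seq y n) (seq y K) (cy n K m₂ N≤K) ⟩
      seq y K ℚ.+ d                       ≤⟨ ℚ.+-monoˡ-≤ d a ⟩
      seq x K ℚ.+ h ℚ.+ d                 ≤⟨ ℚ.+-monoˡ-≤ d (ℚ.+-monoˡ-≤ h (close (seq x K) (seq x n) (cx K n M≤K m₁))) ⟩
      seq x n ℚ.+ d ℚ.+ h ℚ.+ d           ≡⟨ solve 3 (λ x d h → ((x :+ d) :+ h) :+ d := (x :+ h) :+ (d :+ d)) refl (seq x n) d h ⟩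
      seq x n ℚ.+ h ℚ.+ (d ℚ.+ d)         ≡⟨ cong (seq x n ℚ.+ h ℚ.+_) dd ⟩
      seq x n ℚ.+ h ℚ.+ g                 ≤⟨ p≤p+ε _ (½-pos (½-pos l)) ⟩
      seq x n ℚ.+ h ℚ.+ g ℚ.+ g           ≡⟨ ℚ.+-assoc (seq x n ℚ.+ h) g g ⟩
      seq x n ℚ.+ h ℚ.+ (g ℚ.+ g)         ≡⟨ cong (seq x n ℚ.+ h ℚ.+_) (halves h) ⟩
      seq x n ℚ.+ h ℚ.+ h                 ≡⟨ trans (ℚ.+-assoc (seq x n) h h) (cong (seq x n ℚ.+_) (halves ε)) ⟩
      seq x n ℚ.+ ε                       ∎
    where open ℚ.≤-Reasoning
  go (no ¬a) = ⊥-elim (¬p (g , ½-pos (½-pos l) , K , λ n m → let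
      m₁ = ℕ.≤-trans M≤K m
      m₂ = ℕ.≤-trans N≤K m
    in shift-≤ (ℚ.- d) (solve 3 (λ x g d → ((x :+ g) :+ d) :- d := x :+ g) refl (seq x n) g d)
                       (solve 2 (λ y d → (y :+ d) :- d := y) refl (seq y n) d)
    (begin
      seq x n ℚ.+ g ℚ.+ d                 ≤⟨ ℚ.+-monoˡ-≤ d (ℚ.+-monoˡ-≤ g (close (seq x n) (seq x K) (cx n K m₁ M≤K))) ⟩
      seq x K ℚ.+ d ℚ.+ g ℚ.+ d           ≡⟨ solve 3 (λ x d g → ((x :+ d) :+ g) :+ d := x :+ ((d :+ d) :+ g)) refl (seq x K) d g ⟩
      seq x K ℚ.+ (d ℚ.+ d ℚ.+ g)         ≡⟨ cong (seq x K ℚ.+_) (trans (cong (ℚ._+ g) dd) (halves h)) ⟩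
      seq x K ℚ.+ h                       ≤⟨ ℚ.<⇒≤ (ℚ.≰⇒> ¬a) ⟩
      seq y K                             ≤⟨ close (seq y K) (seq y n) (cy K n N≤K m₂) ⟩
      seq y n ℚ.+ d                       ∎)))
    where open ℚ.≤-Reasoning

Trichotomy : Seq → Seq → Set
Trichotomy x y = x ≪ y ⊎ x ≈ y ⊎ y ≪ x

¬¬-trichotomy : ∀ x y → ¬ ¬ Trichotomy (seq x) (seq y)
¬¬-trichotomy x y k = ¬¬-excluded-middle λ
  { (yes p) → k (inj₁ (≪-intro p))
  ; (no ¬p) → ¬¬-excluded-middle λ
      { (yes q) → k (inj₂ (inj₂ (≪-intro q)))
      ; (no ¬q) → k (inj₂ (inj₁ (≲-intro (≮ᴿ⇒≥ᴿ y x ¬q) , ≲-intro (≮ᴿ⇒≥ᴿ x y ¬p)))) } }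

≈-sym : ∀ {x y} → x ≈ y → y ≈ x
≈-sym (p , q) = q , p

≈-trans : ∀ {x y z} → x ≈ y → y ≈ z → x ≈ z
≈-trans (p , p′) (q , q′) = ≲-trans p q , ≲-trans q′ p′

module _ {x y x′ y′ : Seq} (d : Seq) (ex : ∀ n → x n ℚ.+ d n ≡ x′ n) (ey : ∀ n → y n ℚ.+ d n ≡ y′ n) where
  private
    swap : ∀ (x : Seq) n ε → x n ℚ.+ ε ℚ.+ d n ≡ x n ℚ.+ d n ℚ.+ ε
    swap x n ε = solve 3 (λ x ε d → (x :+ ε) :+ d := (x :+ d) :+ ε) refl (x n) ε (d n)

  ≲-shift : x ≲ y → x′ ≲ y′
  ≲-shift = ≲-map λ n ε → shift-≤ (d n) (ex n) (trans (swap y n ε) (cong (ℚ._+ ε) (ey n)))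

  ≪-shift : x ≪ y → x′ ≪ y′
  ≪-shift (≪-intro (ε , l , N , h)) = ≪-intro (ε , l , N , λ n m →
    shift-≤ (d n) (trans (swap x n ε) (cong (ℚ._+ ε) (ex n))) (ey n) (h n m))

≈-shift : ∀ {x y x′ y′ : Seq} d → (∀ n → x n ℚ.+ d ≡ x′ n) → (∀ n → y n ℚ.+ d ≡ y′ n) → x ≈ y → x′ ≈ y′
≈-shift d ex ey (p , q) = ≲-shift (λ _ → d) ex ey p , ≲-shift (λ _ → d) ey ex q

≈-⊕⇒0 : ∀ {x : Seq} {q} → x ≈ x ⊕ q → q ≡ 0ℚ
≈-⊕⇒0 {x} {q} (p , p′) with ℚ.<-cmp q 0ℚ
... | tri≈ _ e _ = e
... | tri< l _ _ = ⊥-elim (≪⇒¬≳ {x ⊕ q} {x} (≪-intro (ℚ.- q , ℚ.neg-antimono-< l , 0 , λ n _ → ℚ.≤-reflexive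
        (solve 2 (λ x q → (x :+ q) :+ (:- q) := x) refl (x n) q))) p)
... | tri> _ _ l = ⊥-elim (≪⇒¬≳ {x} {x ⊕ q} (≪-intro (q , l , 0 , λ n _ → ℚ.≤-refl)) p′)

-- Approximation with exact rational differences

-- Sequences that differ by a rational constant in the limit are replaced by
-- sequences that differ by this constant termwise.

Exact : ∀ {n} → (x z : Fin n → Seq) → Set
Exact x z = ∀ i j q → x i ≈ x j ⊕ q → ∀ m → z i m ≡ z j m ℚ.+ q

-- Induction on `n`. If the new sequence is a rational translate of one already treated, the
-- representative of that one is translated too; otherwise the new sequence keeps itself and is
-- compared exactly only with itself. Which case holds is undecidable, hence the double negation.
representatives : ∀ n (x : Fin n → Seq) → ¬ ¬ (Σ[ z ∈ (Fin n → Seq) ] (∀ i → z i ≈ x i) × Exact x z)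
representatives zero    x k = k ((λ ()) , (λ ()) , λ ())
representatives (suc n) x k = representatives n (x ∘ suc) λ (z , z≈x , ex) →
  ¬¬-excluded-middle {A = ∃[ j ] ∃[ r ] x zero ≈ x (suc j) ⊕ r} λ
  { (yes (j , r , p)) → k ((λ m → z j m ℚ.+ r) F.∷ z ,
      (λ { zero → ≈-trans (≈-shift r (λ _ → refl) (λ _ → refl) (z≈x j)) (≈-sym p) ; (suc i) → z≈x i }) ,
      λ { zero zero q h m → zero-shift (x zero) q _ h
        ; zero (suc i) q h m → trans (cong (ℚ._+ r) (ex j i (q ℚ.- r)
            (≈-shift (ℚ.- r) (λ n → solve 2 (λ x r → (x :+ r) :+ (:- r) := x) refl (x (suc j) n) r)
                             (λ n → solve 3 (λ x q r → (x :+ q) :+ (:- r) := x :+ (q :+ (:- r))) refl (x (suc i) n) q r)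
              (≈-trans (≈-sym p) h)) m))
            (solve 3 (λ z q r → (z :+ (q :+ (:- r))) :+ r := z :+ q) refl (z i m) q r)
        ; (suc i) zero q h m → trans (ex i j (r ℚ.+ q) (≈-trans h
            (≈-shift q (λ _ → refl) (λ n → ℚ.+-assoc (x (suc j) n) r q) p)) m) (sym (ℚ.+-assoc (z j m) r q))
        ; (suc i) (suc i′) → ex i i′ })
  ; (no new) → k (x zero F.∷ z , (λ { zero → ≲-refl , ≲-refl ; (suc i) → z≈x i }) ,
      λ { zero zero q h m → zero-shift (x zero) q _ h
        ; zero (suc i) q h m → ⊥-elim (new (i , q , h))
        ; (suc i) zero q h m → ⊥-elim (new (i , ℚ.- q , ≈-sym
            (≈-shift (ℚ.- q) (λ _ → refl) (λ n → solve 2 (λ x q → (x :+ q) :+ (:- q) := x) refl (x zero n) q) h)))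
        ; (suc i) (suc i′) → ex i i′ }) }
  where
  zero-shift : ∀ (x : Seq) q p → x ≈ x ⊕ q → p ≡ p ℚ.+ q
  zero-shift x q p h = sym (trans (cong (p ℚ.+_) (≈-⊕⇒0 {x} {q} h)) (ℚ.+-identityʳ p))

data Ordered (x y : Seq) (p q : ℚ) : Set where
  less    : x ≪ y → p ℚ.< q → Ordered x y p q
  equal   : x ≈ y → p ≡ q → Ordered x y p q
  greater : y ≪ x → q ℚ.< p → Ordered x y p q

module _ {x y : Seq} {p q : ℚ} where
  ordered-≤ : Ordered x y p q → x ≲ y ⇔ p ℚ.≤ q
  ordered-≤ (less l m)        = mk⇔ (λ _ → ℚ.<⇒≤ m) (λ _ → ≪⇒≲ l)
  ordered-≤ (equal (e , _) m) = mk⇔ (λ _ → ℚ.≤-reflexive m) (λ _ → e)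
  ordered-≤ (greater l m)     = mk⇔ (λ h → ⊥-elim (≪⇒¬≳ l h)) (λ h → ⊥-elim (ℚ.<-irrefl refl (ℚ.<-≤-trans m h)))

  ordered-< : Ordered x y p q → x ≪ y ⇔ p ℚ.< q
  ordered-< (less l m)        = mk⇔ (λ _ → m) (λ _ → l)
  ordered-< (equal (_ , e) m) = mk⇔ (λ h → ⊥-elim (≪⇒¬≳ h e)) (λ h → ⊥-elim (ℚ.<-irrefl m h))
  ordered-< (greater l m)     = mk⇔ (λ h → ⊥-elim (≪⇒¬≳ h (≪⇒≲ l))) (λ h → ⊥-elim (ℚ.<-asym m h))

  ordered-sym : Ordered x y p q → Ordered y x q p
  ordered-sym (less l m)    = greater l m
  ordered-sym (equal e m)   = equal (≈-sym e) (sym m)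
  ordered-sym (greater l m) = less l m

module _ {p n} (ρ : TimedWord p n) where
  Agree : (Fin n → ℚ) → ℕ → Fin n → Fin n → Set
  Agree q c i k = Ordered (seq (τ ρ i) ⊕ ι c) (seq (τ ρ k)) (q i ℚ.+ ι c) (q k)

  AgreeOn : (Fin n → ℚ) → Interval ℕ → Set
  AgreeOn q (l ,, u) = ∀ i k → Agree q (lower-const l) i k × Agree q (upper-const u) i k

  difference : ∀ i k I → τ ρ k -ᴿ τ ρ i ∈ᴵ ⟦ I ⟧ᴵ ⇔ τ ρ k ∈ᴵ τ ρ i +ᴵ I
  difference i k = λ
    { (([ a) ,, (b ])) → ≤-lower a ×-⇔ ≤-upper b
    ; (([ a) ,, (b ⦆)) → ≤-lower a ×-⇔ <-upper b
    ; (([ a) ,, ∞⦆)    → ≤-lower a ×-⇔ mk⇔ id id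
    ; ((⦅ a) ,, (b ])) → <-lower a ×-⇔ ≤-upper b
    ; ((⦅ a) ,, (b ⦆)) → <-lower a ×-⇔ <-upper b
    ; ((⦅ a) ,, ∞⦆)    → <-lower a ×-⇔ mk⇔ id id }
    where
    t = seq (τ ρ i)
    add = λ c n → ℚ.+-comm (ι c) (t n)
    subtract = λ c n → solve 2 (λ t c → (t :+ c) :+ (:- t) := c) refl (t n) (ι c)
    restore = λ n → solve 2 (λ t t′ → (t′ :+ (:- t)) :+ t := t′) refl (t n) (seq (τ ρ k) n)

    via-≲ : ∀ x y x′ y′ → (seq x ≲ seq y → seq x′ ≲ seq y′) → (seq x′ ≲ seq y′ → seq x ≲ seq y) →
            x ≤ᴿ y ⇔ x′ ≤ᴿ y′
    via-≲ x y x′ y′ f g = ⇔-trans (⇔-sym (≲⇔≤ᴿ {x} {y})) (⇔-trans (mk⇔ f g) (≲⇔≤ᴿ {x′} {y′}))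
    via-≪ : ∀ x y x′ y′ → (seq x ≪ seq y → seq x′ ≪ seq y′) → (seq x′ ≪ seq y′ → seq x ≪ seq y) →
            x <ᴿ y ⇔ x′ <ᴿ y′
    via-≪ x y x′ y′ f g = ⇔-trans (⇔-sym (≪⇔<ᴿ {x} {y})) (⇔-trans (mk⇔ f g) (≪⇔<ᴿ {x′} {y′}))

    ≤-lower : ∀ a → fromℕ a ≤ᴿ τ ρ k -ᴿ τ ρ i ⇔ τ ρ i +ᴿ fromℕ a ≤ᴿ τ ρ k
    ≤-lower a = via-≲ (fromℕ a) (τ ρ k -ᴿ τ ρ i) (τ ρ i +ᴿ fromℕ a) (τ ρ k)
      (≲-shift t (add a) restore) (≲-shift (ℚ.-_ ∘ t) (subtract a) (λ _ → refl))
    <-lower : ∀ a → fromℕ a <ᴿ τ ρ k -ᴿ τ ρ i ⇔ τ ρ i +ᴿ fromℕ a <ᴿ τ ρ k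
    <-lower a = via-≪ (fromℕ a) (τ ρ k -ᴿ τ ρ i) (τ ρ i +ᴿ fromℕ a) (τ ρ k)
      (≪-shift t (add a) restore) (≪-shift (ℚ.-_ ∘ t) (subtract a) (λ _ → refl))
    ≤-upper : ∀ b → τ ρ k -ᴿ τ ρ i ≤ᴿ fromℕ b ⇔ τ ρ k ≤ᴿ τ ρ i +ᴿ fromℕ b
    ≤-upper b = via-≲ (τ ρ k -ᴿ τ ρ i) (fromℕ b) (τ ρ k) (τ ρ i +ᴿ fromℕ b)
      (≲-shift t restore (add b)) (≲-shift (ℚ.-_ ∘ t) (λ _ → refl) (subtract b))
    <-upper : ∀ b → τ ρ k -ᴿ τ ρ i <ᴿ fromℕ b ⇔ τ ρ k <ᴿ τ ρ i +ᴿ fromℕ b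
    <-upper b = via-≪ (τ ρ k -ᴿ τ ρ i) (fromℕ b) (τ ρ k) (τ ρ i +ᴿ fromℕ b)
      (≪-shift t restore (add b)) (≪-shift (ℚ.-_ ∘ t) (λ _ → refl) (subtract b))

-- Scaling rational times to ticks

-- Ticks of length 1 / N, with the origin shifted by s.

module _ {n N} (0<N : 0 ℕ.< N) (q : Fin n → ℚ) (s : ℚ) (T : Fin n → ℕ)
         (ticks : ∀ i → ι (T i) ≡ (q i ℚ.+ s) ℚ.* ι N) where
  private
    instance
      N-pos : Positive (ι N)
      N-pos = ι-pos 0<N
      N-nonNeg : NonNegative (ι N)
      N-nonNeg = ℚ.pos⇒nonNeg (ι N)

    scale-≤ : ∀ x y → x ℚ.≤ y ⇔ (x ℚ.+ s) ℚ.* ι N ℚ.≤ (y ℚ.+ s) ℚ.* ι N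
    scale-≤ x y = mk⇔ (λ l → ℚ.*-monoʳ-≤-nonNeg (ι N) (ℚ.+-monoˡ-≤ s l))
      (λ l → shift-≤ (ℚ.- s) (cancel x) (cancel y) (ℚ.*-cancelʳ-≤-pos {x ℚ.+ s} {y ℚ.+ s} (ι N) l))
      where
      cancel : ∀ x → (x ℚ.+ s) ℚ.+ (ℚ.- s) ≡ x
      cancel x = solve 2 (λ x s → (x :+ s) :+ (:- s) := x) refl x s

    delayed : ∀ i c → ι (T i ℕ.+ c ℕ.* N) ≡ (q i ℚ.+ ι c ℚ.+ s) ℚ.* ι N
    delayed i c = trans (ι-+ (T i) (c ℕ.* N)) (trans (cong₂ ℚ._+_ (ticks i) (ι-* c N))
      (solve 4 (λ q s c N → ((q :+ s) :* N) :+ (c :* N) := ((q :+ c) :+ s) :* N) refl (q i) s (ι c) (ι N)))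

  tick-≤ : ∀ i k c → q i ℚ.+ ι c ℚ.≤ q k ⇔ T i ℕ.+ c ℕ.* N ℕ.≤ T k
  tick-≤ i k c = ⇔-trans (scale-≤ _ _) (⇔-trans
    (mk⇔ (subst₂ ℚ._≤_ (sym (delayed i c)) (sym (ticks k))) (subst₂ ℚ._≤_ (delayed i c) (ticks k)))
    (⇔-sym (ι-≤ _ _)))

  tick-≥ : ∀ i k c → q k ℚ.≤ q i ℚ.+ ι c ⇔ T k ℕ.≤ T i ℕ.+ c ℕ.* N
  tick-≥ i k c = ⇔-trans (scale-≤ _ _) (⇔-trans
    (mk⇔ (subst₂ ℚ._≤_ (sym (ticks k)) (sym (delayed i c))) (subst₂ ℚ._≤_ (ticks k) (delayed i c)))
    (⇔-sym (ι-≤ _ _)))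

  tick-< : ∀ i k c → q i ℚ.+ ι c ℚ.< q k ⇔ T i ℕ.+ c ℕ.* N ℕ.< T k
  tick-< i k c = mk⇔
    (λ l → ℕ.≰⇒> λ m → ℚ.<-irrefl refl (ℚ.<-≤-trans l (tick-≥ i k c .from m)))
    (λ l → ℚ.≰⇒> λ m → ℕ.<⇒≱ l (tick-≥ i k c .to m))

  tick-> : ∀ i k c → q k ℚ.< q i ℚ.+ ι c ⇔ T k ℕ.< T i ℕ.+ c ℕ.* N
  tick-> i k c = mk⇔
    (λ l → ℕ.≰⇒> λ m → ℚ.<-irrefl refl (ℚ.<-≤-trans l (tick-≤ i k c .from m)))
    (λ l → ℚ.≰⇒> λ m → ℕ.<⇒≱ l (tick-≤ i k c .to m))

private
  clear : ∀ r → 0ℚ ℚ.≤ r → ∃[ d ] 0 ℕ.< d × ∃[ a ] r ℚ.* ι d ≡ ι a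
  clear r@(mkℚ (ℤ.+ a) d-1 c) _ = suc d-1 , s≤s z≤n , a , ℚ.toℚᵘ-injective
    (ℚᵘ.≃-trans (ℚ.toℚᵘ-homo-* r (ι (suc d-1))) (ℚᵘ.≃-trans
      (ℚᵘ.*-congˡ {mkℚᵘ (ℤ.+ a) d-1} (ℚ.toℚᵘ-fromℚᵘ (mkℚᵘ (ℤ.+ suc d-1) 0)))
      (ℚᵘ.≃-trans (*≡* eq) (ℚᵘ.≃-sym (ℚ.toℚᵘ-fromℚᵘ (mkℚᵘ (ℤ.+ a) 0))))))
    where
    eq : (ℤ.+ a ℤ.* ℤ.+ suc d-1) ℤ.* ℤ.+ 1 ≡ ℤ.+ a ℤ.* ℤ.+ (suc d-1 ℕ.* 1)
    eq = trans (ℤ.*-identityʳ _) (cong (λ d → ℤ.+ a ℤ.* ℤ.+ d) (sym (ℕ.*-identityʳ (suc d-1))))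
  clear (mkℚ ℤ.-[1+ a ] d-1 c) (*≤* ())

common-denominator : ∀ n (r : Fin n → ℚ) → (∀ i → 0ℚ ℚ.≤ r i) →
  ∃[ D ] 0 ℕ.< D × (Σ[ T ∈ (Fin n → ℕ) ] ∀ i → r i ℚ.* ι D ≡ ι (T i))
common-denominator zero    r h = 1 , s≤s z≤n , (λ ()) , λ ()
common-denominator (suc n) r h with clear (r zero) (h zero) | common-denominator n (r ∘ suc) (h ∘ suc)
... | d , 0<d , a , e | D , 0<D , T , es = d ℕ.* D , ℕ.*-mono-< 0<d 0<D , (a ℕ.* D) F.∷ (λ i → T i ℕ.* d) , λ
  { zero → trans (cong (r zero ℚ.*_) (ι-* d D)) (trans (sym (ℚ.*-assoc (r zero) (ι d) (ι D)))
             (trans (cong (ℚ._* ι D) e) (sym (ι-* a D))))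
  ; (suc i) → trans (cong (r (suc i) ℚ.*_) (trans (ι-* d D) (ℚ.*-comm (ι d) (ι D))))
      (trans (sym (ℚ.*-assoc (r (suc i)) (ι D) (ι d))) (trans (cong (ℚ._* ι d) (es i)) (sym (ι-* (T i) d)))) }

map-intervals : ∀ {p} {P Q : Interval ℕ → Set} → (∀ I → P I → Q I) →
                (φ : Formula p) → AllIntervals P φ → AllIntervals Q φ
map-intervals h (prop a)               _              = tt
map-intervals h true                   _              = tt
map-intervals h (φ ∧′ ψ)               (a , b)        = map-intervals h φ a , map-intervals h ψ b
map-intervals h (¬′ φ)                 a              = map-intervals h φ a
map-intervals h (C[ I ,≥ c ] φ)        (p , a)        = h I p , map-intervals h φ a
map-intervals h (φ U[ I , # θ ≥ c ] ψ) (p , a , b , d) =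
  h I p , map-intervals h φ a , map-intervals h θ b , map-intervals h ψ d
map-intervals h (φ U[ I , # θ < c ] ψ) (p , a , b , d) =
  h I p , map-intervals h φ a , map-intervals h θ b , map-intervals h ψ d

module _ {p n} (ρ : TimedWord p n) {N} (0<N : 0 ℕ.< N) (q : Fin n → ℚ) (s : ℚ) (T : Fin n → ℕ)
         (ticks : ∀ i → ι (T i) ≡ (q i ℚ.+ s) ℚ.* ι N) where
  open Ticks N

  private
    above-≤ : ∀ i k c → Agree ρ q c i k → ((T i ℕ.+ c ℕ.* N) ≤ᵇ T k) reflects (τ ρ i +ᴿ fromℕ c ≤ᴿ τ ρ k)
    above-≤ i k c a = ⇔-trans (⇔-sym (≲⇔≤ᴿ {τ ρ i +ᴿ fromℕ c} {τ ρ k}))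
      (⇔-trans (ordered-≤ a) (⇔-trans (tick-≤ 0<N q s T ticks i k c) (reflects-≥ _ _)))

    above-< : ∀ i k c → Agree ρ q c i k → ((T i ℕ.+ c ℕ.* N) <ᵇ T k) reflects (τ ρ i +ᴿ fromℕ c <ᴿ τ ρ k)
    above-< i k c a = ⇔-trans (⇔-sym (≪⇔<ᴿ {τ ρ i +ᴿ fromℕ c} {τ ρ k}))
      (⇔-trans (ordered-< a) (⇔-trans (tick-< 0<N q s T ticks i k c) (reflects-≥ _ _)))

    below-≤ : ∀ i k c → Agree ρ q c i k → (T k ≤ᵇ (T i ℕ.+ c ℕ.* N)) reflects (τ ρ k ≤ᴿ τ ρ i +ᴿ fromℕ c)
    below-≤ i k c a = ⇔-trans (⇔-sym (≲⇔≤ᴿ {τ ρ k} {τ ρ i +ᴿ fromℕ c}))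
      (⇔-trans (ordered-≤ (ordered-sym a)) (⇔-trans (tick-≥ 0<N q s T ticks i k c) (reflects-≥ _ _)))

    below-< : ∀ i k c → Agree ρ q c i k → (T k <ᵇ (T i ℕ.+ c ℕ.* N)) reflects (τ ρ k <ᴿ τ ρ i +ᴿ fromℕ c)
    below-< i k c a = ⇔-trans (⇔-sym (≪⇔<ᴿ {τ ρ k} {τ ρ i +ᴿ fromℕ c}))
      (⇔-trans (ordered-< (ordered-sym a)) (⇔-trans (tick-> 0<N q s T ticks i k c) (reflects-≥ _ _)))

    always : true reflects ⊤
    always = mk⇔ (λ _ → refl) (λ _ → tt)

    delayed-in : ∀ I → AgreeOn ρ q I → ∀ i k → inᵀ (T i) (T k) I reflects (τ ρ k ∈ᴵ τ ρ i +ᴵ I)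
    delayed-in (([ a) ,, (b ])) h i k = reflects-∧ (above-≤ i k a (proj₁ (h i k))) (below-≤ i k b (proj₂ (h i k)))
    delayed-in (([ a) ,, (b ⦆)) h i k = reflects-∧ (above-≤ i k a (proj₁ (h i k))) (below-< i k b (proj₂ (h i k)))
    delayed-in (([ a) ,, ∞⦆)    h i k = reflects-∧ (above-≤ i k a (proj₁ (h i k))) always
    delayed-in ((⦅ a) ,, (b ])) h i k = reflects-∧ (above-< i k a (proj₁ (h i k))) (below-≤ i k b (proj₂ (h i k)))
    delayed-in ((⦅ a) ,, (b ⦆)) h i k = reflects-∧ (above-< i k a (proj₁ (h i k))) (below-< i k b (proj₂ (h i k)))
    delayed-in ((⦅ a) ,, ∞⦆)    h i k = reflects-∧ (above-< i k a (proj₁ (h i k))) always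

  timing : ∀ I → AgreeOn ρ q I → Timing ρ (λ I i k → inᵀ (T i) (T k) I) I
  timing I h i k = delayed-in I h i k , ⇔-trans (difference ρ i k I) (delayed-in I h i k)

increasing⇒monotone : ∀ {A t n} {e : Events A n} → Increasing t n e → ∀ i j → toℕ j ≡ suc (toℕ i) →
                      proj₂ (e i) ℕ.≤ proj₂ (e j)
increasing⇒monotone {n = suc (suc _)} (_ , l , _) zero    (suc zero) _ = l
increasing⇒monotone {n = suc n} {e} (_ , ls) (suc i) (suc j) p =
  increasing⇒monotone {e = e ∘ suc} ls i j (ℕ.suc-injective p)

monotone⇒increasing : ∀ {A t} n (e : Events A (suc n)) → t ℕ.≤ proj₂ (e zero) →
  (∀ i j → toℕ j ≡ suc (toℕ i) → proj₂ (e i) ℕ.≤ proj₂ (e j)) → Increasing t (suc n) e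
monotone⇒increasing zero    e l m = l , tt
monotone⇒increasing (suc n) e l m =
  l , monotone⇒increasing n (e ∘ suc) (m zero (suc zero) refl) (λ i j → m (suc i) (suc j) ∘ cong suc)

-- From ticks to reals

constant : ℚ → ℝ
constant q .seq _ = q
constant q .cauchy ε l = 0 , λ _ _ _ _ → subst (λ d → ℚ.∣ d ∣ ℚ.< ε) (sym (ℚ.+-inverseʳ q)) l

constant-≲ : ∀ p q → p ℚ.≤ q → (λ _ → p) ≲ (λ _ → q)
constant-≲ p q l = ≲-map (λ _ ε m → ℚ.≤-trans m (ℚ.+-monoˡ-≤ ε l)) ≲-refl

constant-≪ : ∀ p q → p ℚ.< q → (λ _ → p) ≪ (λ _ → q)
constant-≪ p q l = ≪-intro (q ℚ.- p , subst (ℚ._< q ℚ.- p) (ℚ.+-inverseʳ p) (ℚ.+-monoˡ-< (ℚ.- p) l) , 0 ,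
  λ _ _ → ℚ.≤-reflexive (solve 2 (λ p q → p :+ (q :+ (:- p)) := q) refl p q))

module FromTicks {p n N} (0<N : 0 ℕ.< N) (σ′ : Fin n → Subset p) (nonempty′ : ∀ i → Nonempty (σ′ i)) (T : Fin n → ℕ)
                 (monotone′ : ∀ i j → toℕ j ≡ suc (toℕ i) → T i ℕ.≤ T j) where
  private
    instance
      N-pos : Positive (ι N)
      N-pos = ι-pos 0<N
      N≢0 : ℚ.NonZero (ι N)
      N≢0 = ℚ.pos⇒nonZero (ι N)

    ν : ℚ
    ν = ℚ.1/ ι N

    instance
      ν-pos : Positive ν
      ν-pos = ℚ.1/pos⇒pos (ι N)
      ν-nonNeg : NonNegative ν
      ν-nonNeg = ℚ.pos⇒nonNeg ν

    q : Fin n → ℚ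
    q i = ι (T i) ℚ.* ν

    scaled : ∀ s t → s ℕ.≤ t → ι s ℚ.* ν ℚ.≤ ι t ℚ.* ν
    scaled s t l = ℚ.*-monoʳ-≤-nonNeg ν (ι-≤ _ _ .to l)

    ticks : ∀ i → ι (T i) ≡ (q i ℚ.+ 0ℚ) ℚ.* ι N
    ticks i = sym (trans (cong (ℚ._* ι N) (ℚ.+-identityʳ (q i))) (trans (ℚ.*-assoc (ι (T i)) ν (ι N))
      (trans (cong (ι (T i) ℚ.*_) (ℚ.*-inverseˡ (ι N))) (ℚ.*-identityʳ _))))

  timedWord : TimedWord p n
  timedWord .σ = σ′
  timedWord .τ i = constant (q i)
  timedWord .TimedWord.nonempty = nonempty′
  timedWord .nonneg i = ≲⇔≤ᴿ {fromℕ 0} {constant (q i)} .to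
    (constant-≲ (ι 0) (q i) (ℚ.≤-trans (ℚ.≤-reflexive (sym (ℚ.*-zeroˡ ν))) (scaled 0 (T i) z≤n)))
  timedWord .monotone i j e =
    ≲⇔≤ᴿ {constant (q i)} {constant (q j)} .to (constant-≲ (q i) (q j) (scaled (T i) (T j) (monotone′ i j e)))

  private
    agree : ∀ c i k → Agree timedWord q c i k
    agree c i k = compare (q i ℚ.+ ι c) (q k)
      where
      compare : ∀ x y → Ordered (λ _ → x) (λ _ → y) x y
      compare x y with ℚ.<-cmp x y
      ... | tri< l _ _    = less (constant-≪ x y l) l
      ... | tri≈ _ refl _ = equal (≲-refl , ≲-refl) refl
      ... | tri> _ _ l    = greater (constant-≪ y x l) l

  tick-timing : ∀ I → Timing timedWord (λ I i k → Ticks.inᵀ N (T i) (T k) I) I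
  tick-timing I = timing timedWord 0<N q 0ℚ T ticks I λ i k →
    agree (lower-const (Interval.lower I)) i k , agree (upper-const (Interval.upper I)) i k

-- From reals to ticks

-- Under the double negation, finitely many facts obtained classically, such as trichotomies of
-- reals, can be given a common index.
Eventually : (ℕ → Set) → Set
Eventually P = ¬ ¬ (∃[ N ] ∀ n → N ℕ.≤ n → P n)

eventually-∧ : ∀ {P Q : ℕ → Set} → Eventually P → Eventually Q → Eventually (λ n → P n × Q n)
eventually-∧ p q k = p λ (M , f) → q λ (N , g) → k (M ⊔ N , λ n l →
  f n (ℕ.m⊔n≤o⇒m≤o M N l) , g n (ℕ.m⊔n≤o⇒n≤o M N l))

eventually-always : ∀ {P : ℕ → Set} → (∀ n → P n) → Eventually P
eventually-always p k = k (0 , λ n _ → p n)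

eventually-map : ∀ {P Q : ℕ → Set} → (∀ n → P n → Q n) → Eventually P → Eventually Q
eventually-map f p k = p λ (N , g) → k (N , λ n l → f n (g n l))

eventually-∀ : ∀ m {P : Fin m → ℕ → Set} → (∀ i → Eventually (P i)) → Eventually (λ n → ∀ i → P i n)
eventually-∀ zero    h = eventually-always λ _ ()
eventually-∀ (suc m) h = eventually-map (λ { n (p , q) zero → p ; n (p , q) (suc i) → q i })
  (eventually-∧ (h zero) (eventually-∀ m (h ∘ suc)))

eventually-intervals : ∀ {p} {P : Interval ℕ → ℕ → Set} → (∀ I → Eventually (P I)) → (φ : Formula p) →
                       Eventually (λ n → AllIntervals (λ I → P I n) φ)
eventually-intervals h (prop a)               = eventually-always λ _ → tt
eventually-intervals h true                   = eventually-always λ _ → tt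
eventually-intervals h (φ ∧′ ψ)               = eventually-∧ (eventually-intervals h φ) (eventually-intervals h ψ)
eventually-intervals h (¬′ φ)                 = eventually-intervals h φ
eventually-intervals h (C[ I ,≥ c ] φ)        = eventually-∧ (h I) (eventually-intervals h φ)
eventually-intervals h (φ U[ I , # θ ≥ c ] ψ) = eventually-∧ (h I) (eventually-∧ (eventually-intervals h φ)
  (eventually-∧ (eventually-intervals h θ) (eventually-intervals h ψ)))
eventually-intervals h (φ U[ I , # θ < c ] ψ) = eventually-∧ (h I) (eventually-∧ (eventually-intervals h φ)
  (eventually-∧ (eventually-intervals h θ) (eventually-intervals h ψ)))

module ToTicks {p n} (ρ : TimedWord p (suc n)) (φ : Formula p) where
  record Discrete : Set where
    field
      {N}      : ℕ
      positive : 0 ℕ.< N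
      T        : Fin (suc n) → ℕ
      start    : T zero ≡ N
      increase : ∀ i j → toℕ j ≡ suc (toℕ i) → T i ℕ.≤ T j
      timings  : AllIntervals (Timing ρ (λ I i k → Ticks.inᵀ N (T i) (T k) I)) φ

  private
    -- A strict inequality between limits holds termwise from some index on. An equality need not,
    -- so `ex` has to provide it.
    ordered-eventually : ∀ {x y z w} → z ≈ x → w ≈ y → (x ≈ y → ∀ m → z m ≡ w m) → Trichotomy x y →
                         ∃[ N ] ∀ m → N ℕ.≤ m → Ordered x y (z m) (w m)
    ordered-eventually (zx , _) (_ , yw) ex (inj₁ l) =
      let (N , h) = ≪-eventually zx l yw in N , λ m N≤m → less l (h m N≤m)
    ordered-eventually _ _ ex (inj₂ (inj₁ e)) = 0 , λ m _ → equal e (ex e m)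
    ordered-eventually (_ , xz) (wy , _) ex (inj₂ (inj₂ l)) =
      let (N , h) = ≪-eventually wy l xz in N , λ m N≤m → greater l (h m N≤m)

    agree-eventually : ∀ {z} → (∀ i → z i ≈ seq (τ ρ i)) → Exact (seq ∘ τ ρ) z → ∀ c i k →
                       Eventually (λ m → Agree ρ (λ i → z i m) c i k)
    agree-eventually {z} z≈τ ex c i k fail = ¬¬-trichotomy (τ ρ i +ᴿ fromℕ c) (τ ρ k)
      (fail ∘ ordered-eventually {seq (τ ρ i) ⊕ ι c} {seq (τ ρ k)} {z i ⊕ ι c} {z k}
              (≈-shift (ι c) (λ _ → refl) (λ _ → refl) (z≈τ i)) (z≈τ k)
              (λ e m → sym (ex k i (ι c) (≈-sym e) m)))

    least : ∀ n {q : Fin (suc n) → ℚ} → (∀ i j → toℕ j ≡ suc (toℕ i) → q i ℚ.≤ q j) → ∀ i → q zero ℚ.≤ q i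
    least n       m zero    = ℚ.≤-refl
    least (suc n) m (suc i) = ℚ.≤-trans (m zero (suc zero) refl) (least n (λ i j → m (suc i) (suc j) ∘ cong suc) i)

    q+0-monotone : ∀ {q} → (∀ i k → Agree ρ q 0 i k) → ∀ i j → toℕ j ≡ suc (toℕ i) → q i ℚ.+ ι 0 ℚ.≤ q j
    q+0-monotone agree₀ i j e = ordered-≤ (agree₀ i j) .to
      (≲-trans (≲-map {t} {t} {t ⊕ ι 0} {t} (λ m ε → subst (ℚ._≤ t m ℚ.+ ε) (sym (ℚ.+-identityʳ (t m)))) ≲-refl)
               (≲⇔≤ᴿ {τ ρ i} {τ ρ j} .from (monotone ρ i j e)))
      where t = seq (τ ρ i)

    discrete : ∀ {q} → (∀ i k → Agree ρ q 0 i k) → AllIntervals (AgreeOn ρ q) φ → Discrete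
    discrete {q} agree₀ agree with common-denominator (suc n) (λ i → q i ℚ.- q zero) (λ i →
        shift-≤ (ℚ.- q zero) (ℚ.+-inverseʳ (q zero)) refl (least n q-monotone i))
      where
      q-monotone : ∀ i j → toℕ j ≡ suc (toℕ i) → q i ℚ.≤ q j
      q-monotone i j e = subst (ℚ._≤ q j) (ℚ.+-identityʳ (q i)) (q+0-monotone agree₀ i j e)
    ... | D , 0<D , T , h = record
      { positive = 0<D
      ; T        = T′
      ; start    = trans (cong (D ℕ.+_) T₀≡0) (ℕ.+-identityʳ D)
      ; increase = λ i j e → subst (ℕ._≤ T′ j) (ℕ.+-identityʳ (T′ i))
          (tick-≤ 0<D q (ℚ.1ℚ ℚ.- q zero) T′ ticks i j 0 .to (q+0-monotone agree₀ i j e))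
      ; timings  = map-intervals (timing ρ 0<D q (ℚ.1ℚ ℚ.- q zero) T′ ticks) φ agree }
      where
      T′ : Fin (suc n) → ℕ
      -- Subtracting `q zero` makes all times nonnegative; the added unit of `D` ticks puts the
      -- first event where a good word expects it.
      T′ i = D ℕ.+ T i
      ticks : ∀ i → ι (T′ i) ≡ (q i ℚ.+ (ℚ.1ℚ ℚ.- q zero)) ℚ.* ι D
      ticks i = trans (ι-+ D (T i)) (trans (cong (ι D ℚ.+_) (sym (h i)))
        (solve 3 (λ d q q₀ → d :+ ((q :- q₀) :* d) := (q :+ (con ℚ.1ℚ :- q₀)) :* d) refl (ι D) (q i) (q zero)))
      T₀≡0 : T zero ≡ 0
      T₀≡0 = ℕ.n≤0⇒n≡0 (ι-≤ (T zero) 0 .from (ℚ.≤-reflexive (trans (sym (h zero))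
        (trans (cong (ℚ._* ι D) (ℚ.+-inverseʳ (q zero))) (ℚ.*-zeroˡ (ι D))))))

  ¬¬-discrete : ¬ ¬ Discrete
  ¬¬-discrete fail = representatives (suc n) (seq ∘ τ ρ) λ (z , z≈τ , ex) →
    let agree = agree-eventually z≈τ ex in
    -- The constant 0 is included besides those of `φ`, so that the order of the time stamps
    -- survives the approximation.
    eventually-∧ (eventually-∀ _ λ i → eventually-∀ _ λ k → agree 0 i k)
      (eventually-intervals {P = λ I m → AgreeOn ρ (λ i → z i m) I}
        (λ I → eventually-∀ _ λ i → eventually-∀ _ λ k → eventually-∧
          (agree (lower-const (Interval.lower I)) i k) (agree (upper-const (Interval.upper I)) i k)) φ)
      λ (N , h) → let (a₀ , a) = h N ℕ.≤-refl in fail (discrete a₀ a)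

-- Decidability of satisfiability

subsets : ∀ n → List (Subset n)
subsets zero    = [] ∷ []
subsets (suc n) = cartesianProductWith Vec._∷_ bools (subsets n)

∈-subsets : ∀ {n} (s : Subset n) → s ∈ subsets n
∈-subsets []      = here refl
∈-subsets (b ∷ s) = ∈-cartesianProductWith⁺ Vec._∷_ (∈-bools b) (∈-subsets s)

theorem3 : ∀ (p : ℕ) (φ : Formula p) → Dec (∃[ n ] Σ[ ρ ∈ TimedWord p (suc n) ] (ρ ⊨ φ))
theorem3 p φ = map′ sound complete goodWord?
  where
  A : Set
  A = Subset p × Label φ

  letters : List A
  letters = cartesianProduct (filter nonempty? (subsets p)) (labels φ)

  open Emptiness (monitor φ proj₁ proj₂) letters (λ (s , l) → value φ s l Bool.≟ true)

  sound : GoodWord → ∃[ n ] Σ[ ρ ∈ TimedWord p (suc n) ] (ρ ⊨ φ)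
  sound w = m , timedWord , sat timedWord _ φ (all-intervals tick-timing φ) zero .from
      (trans (sym (good⇒value N positive φ proj₁ proj₂ {e = word} increasing good zero)) start)
    where
    open GoodWord w
    nonempty-letter : ∀ i → Nonempty (proj₁ (proj₁ (word i)))
    nonempty-letter i = proj₂ (∈-filter⁻ nonempty? {xs = subsets p}
      (proj₁ (∈-cartesianProduct⁻ (filter nonempty? (subsets p)) (labels φ) (letter i))))
    open FromTicks positive (proj₁ ∘ proj₁ ∘ word) nonempty-letter (proj₂ ∘ word)
      (increasing⇒monotone {e = word} increasing)

  complete : (∃[ n ] Σ[ ρ ∈ TimedWord p (suc n) ] (ρ ⊨ φ)) → GoodWord
  complete (n , ρ , ρ⊨φ) = decidable-stable goodWord? λ ¬w → ToTicks.¬¬-discrete ρ φ (¬w ∘ good-word)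
    where
    open ToTicks ρ φ
    good-word : Discrete → GoodWord
    good-word d = record
      { positive   = positive
      ; word       = e
      ; start      = trans (value-truth (σ ρ) in? φ zero) (sat ρ in? φ timings zero .to ρ⊨φ)
      ; letter     = λ i → ∈-cartesianProduct⁺ (∈-filter⁺ nonempty? (∈-subsets (σ ρ i)) (TimedWord.nonempty ρ i))
                                               (∈-labels φ _)
      ; time₀      = start
      ; increasing = inc
      ; good       = truth⇒good N positive φ proj₁ proj₂ {e = e} inc (λ _ → refl) }
      where
      open Discrete d
      in? : Interval ℕ → Fin (suc n) → Fin (suc n) → Bool
      in? I i k = Ticks.inᵀ N (T i) (T k) I
      e : Events A (suc n)
      e i = (σ ρ i , truth (σ ρ) in? φ i) , T i
      inc : Increasing N (suc n) e
      inc = monotone⇒increasing n e (ℕ.≤-reflexive (sym start)) increase
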